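{- Fix $i\in\{1,\dots,m\}$ and let $b_i$ be the smallest non-zero positive value of $\langle\lambda,\check{\gamma}\rangle$ for $\gamma\in\Phi_N^i$ (with $b_i=\infty$ if there is no such value). Let $s\in\mathbb{R}$ be such that $\lambda+s\tilde{\alpha}$ is algebraically integral. Let $\mathcal{M}(r_i,\Pi\otimes|s\tilde{\alpha}|)(1)$ be the premotivic structure described in the context, of weight $\mathrm{wt}=-2is-2$ and with Hodge numbers $h^{p,q}=\dim H^{p,q}$. (1) If $\mathrm{wt}$ is odd, or if $\mathrm{wt}$ is even but $h^{\mathrm{wt}/2,\mathrm{wt}/2}=0$, then $\mathcal{M}(r_i,\Pi\otimes|s\tilde{\alpha}|)(1)$ is critical for $0<s\leq\frac{b_i-1}{i}$. (2) If $\mathrm{wt}$ is even and $h^{\mathrm{wt}/2,\mathrm{wt}/2}\neq 0$, suppose that $F_\infty$ acts on $H^{\mathrm{wt}/2,\mathrm{wt}/2}$ by a scalar (necessarily $(-1)^t$ with $t=0$ or $1$). Then $\mathcal{M}(r_i,\Pi\otimes|s\tilde{\alpha}|)(1)$ is critical for $0<s\leq\frac{b_i-1}{i}$, subject to the extra condition $t=0$.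
   Context: Group-theoretic setting. $G/\mathbb{Q}$ is a connected, split reductive group with split maximal torus $T$, roots $\Phi\subset X^*(T)$, positive roots $\Phi_G^+$, simple positive roots $\Delta_G$, and Weyl group $W_G$; $\check{\gamma}\in X_*(T)$ is the coroot of $\gamma\in\Phi$, and $\langle\cdot,\cdot\rangle$ is the natural pairing $X^*(T)\times X_*(T)\to\mathbb{Z}$, extended to real coefficients. Fix $\alpha\in\Delta_G$ and let $P=MN$ be the maximal parabolic subgroup with unipotent radical $N$ and Levi subgroup $M\supset T$ characterised by $\Delta_M=\Delta_G\setminus\{\alpha\}$. $W_M$ is the Weyl group of $M$. $\Phi_N$ is the set of roots occurring in the Lie algebra of $N$, $\rho_P$ is half the sum of the elements of $\Phi_N$, and $\tilde{\alpha}=\rho_P/\langle\rho_P,\check{\alpha}\rangle$. For $i\ge 1$, $\Phi_N^i=\{\gamma\in\Phi_N:\langle\tilde{\alpha},\check{\gamma}\rangle=i\}$; $m$ is the largest $i$ with $\Phi_N^i\ne\emptyset$. Here $i$ always denotes this positive integer, not $\sqrt{ -1}$. Automorphic setting. $\Pi$ is an irreducible, cuspidal, unitary automorphic representation of $M(\mathbb{A})$, trivial on $A(\mathbb{A})$ where $A=Z(M)^0$. $\lambda\in X^*(T)\otimes\mathbb{R}$ is the infinitesimal character of $\Pi_\infty$ (via the Harish-Chandra isomorphism, with respect to the Lie algebra of $T(\mathbb{R})$), chosen in its $W_M$-orbit to be dominant with respect to $\Delta_M$. One says $\lambda+s\tilde{\alpha}$ is algebraically integral if $\langle\lambda+s\tilde{\alpha},\check{\gamma}\rangle\in\mathbb{Z}$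 for all $\gamma\in\Phi$. Let $\hat{M}\subset\hat{P}\subset\hat{G}$ be the corresponding Levi and maximal parabolic in the Langlands dual group, and $\hat{\mathfrak n}$ the Lie algebra of the unipotent radical of $\hat P$. The adjoint representation $r$ of $\hat M$ on $\hat{\mathfrak n}$ decomposes as $r=\bigoplus_{i=1}^m r_i$, where $r_i$ acts on the sum of the root spaces for $\{\check\gamma:\gamma\in\Phi_N^i\}$. Motivic setting (standing assumption). It is assumed that for $s\in\mathbb{R}$ with $\lambda+s\tilde{\alpha}$ algebraically integral there exists the motive $\mathcal{M}(r_i,\Pi\otimes|s\tilde{\alpha}|)$ over $\mathbb{Q}$ conjecturally attached to $\Pi\otimes|s\tilde{\alpha}|$ and $r_i$, with coefficients in a number field $E\subset\mathbb{C}$, or at least the associated premotivic structure: a Betti realisation $H_B$ (a finite-dimensional $E$-vector space) with an involution $F_\infty$ (complex conjugation) and a Hodge decomposition $H_B\otimes_E\mathbb{C}=\bigoplus_{p,q} H^{p,q}$ such that $F_\infty$ exchanges $H^{p,q}$ and $H^{q,p}$; a de Rham realisation $H_{\mathrm{dR}}$ (an $E$-vector space) with a decreasing filtration $\mathrm{Fil}^\bullet$; and a comparison isomorphism $H_B\otimes_E\mathbb{C}\simeq H_{\mathrm{dR}}\otimes_E\mathbb{C}$ under which $\mathrm{Fil}^k\otimes\mathbb{C}$ corresponds to $\bigoplus_{p\ge k}H^{p,q}$. Its Hodge type, with multiplicities, is $\{(-\langle\lambda,\check{\gamma}\rangle-is,\ \langle\lambda,\check{\gamma}\rangle-is):\gamma\in\Phi_N^i\}$.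 $\mathcal{M}(r_i,\Pi\otimes|s\tilde{\alpha}|)(1)$ is its Tate twist, whose Hodge type is obtained by replacing each $(p,q)$ by $(p-1,q-1)$; so it has weight $\mathrm{wt}=-2is-2$ (that is, $p+q=\mathrm{wt}$ for all $(p,q)$ in the Hodge type). In the claim, $H^{p,q}$, $h^{p,q}$ and $F_\infty$ refer to $H_B(\mathcal{M}(r_i,\Pi\otimes|s\tilde{\alpha}|)(1))\otimes\mathbb{C}$. Following Deligne, $\mathcal{M}(r_i,\Pi\otimes|s\tilde{\alpha}|)(1)$ is called critical if $$\dim\left(H_B(\mathcal{M}(r_i,\Pi\otimes|s\tilde{\alpha}|)(1))^{+}\right)=\dim\left(H_{\mathrm{dR}}(\mathcal{M}(r_i,\Pi\otimes|s\tilde{\alpha}|)(1))/\mathrm{Fil}^0\right),$$ where $+$ denotes the $+1$-eigenspace of $F_\infty$. -}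

module Defs where

open import Algebra.Apartness.Bundles using (HeytingField; HeytingCommutativeRing)
open import Algebra.Bundles using (CommutativeMonoid; CommutativeRing)
open import Algebra.Module.Bundles using (Module)
open import Algebra.Module.Morphism.Structures using (IsModuleHomomorphism; IsModuleIsomorphism)
open import Algebra.Module.Structures.Biased using (IsModuleFromLeft)
open import Algebra.Morphism.Bundles using (RingHomomorphism)
open import Axiom.ExcludedMiddle using (ExcludedMiddle)
open import Data.Empty using (⊥-elim)
open import Data.Fin.Base using (Fin; toℕ; suc)
open import Data.Integer.Base as ℤ using (ℤ; +_; -[1+_]; 0ℤ)
import Data.Integer.Properties as ℤₚ
open import Data.List.Base using (List; filter; allFin; length; foldr; map)
open import Data.List.Relation.Binary.Pointwise.Base using (Pointwise)
open import Data.Maybe.Base using (Maybe; just; nothing)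
open import Data.Nat.Base as ℕ using (ℕ; zero; suc)
import Data.Nat.Properties as ℕₚ
open import Data.Product using (Σ; _×_; _,_; ∃; proj₁; proj₂)
open import Data.Product.Properties using (≡-dec)
open import Data.Rational.Base using (ℚ)
import Data.Rational.Properties as ℚₚ
open import Data.Sum.Base using (_⊎_)
open import Data.Unit.Base using (⊤; tt)
open import Data.Vec.Functional using (Vector)
open import Function.Base using (_∘_)
open import Function.Definitions using (Injective)
open import Level using (0ℓ)
open import Relation.Binary.PropositionalEquality as ≡ using (_≡_; _≢_)
open import Relation.Binary.Structures using (IsEquivalence; IsTotalOrder)
import Relation.Binary.Construct.NonStrictToStrict as ToStrict
open import Relation.Nullary using (¬_; yes; no)
open import Relation.Nullary.Construct.Add.Supremum using (_⁺; ⊤⁺; [_])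
open import Relation.Unary using (Pred; _∈_; U)
import Algebra.Solver.Ring
open import Algebra.Solver.Ring.AlmostCommutativeRing using (AlmostCommutativeRing; fromCommutativeRing; _-Raw-AlmostCommutative⟶_)

CRing : Set₁
CRing = CommutativeRing 0ℓ 0ℓ

Mod : CRing → Set₁
Mod R = Module R 0ℓ 0ℓ

Field : Set₁
Field = HeytingField 0ℓ 0ℓ 0ℓ

fieldRing : Field → CRing
fieldRing K = HeytingCommutativeRing.commutativeRing (HeytingField.heytingCommutativeRing K)

RingHom : CRing → CRing → Set
RingHom R S = RingHomomorphism (CommutativeRing.rawRing R) (CommutativeRing.rawRing S)

-- The negation is v ↦ (- 1#) *ₗ v, so that only the semimodule laws are needed.
module MakeModule (R : CRing) where
  open CommutativeRing R

  mkModule : (A : Set) (_≈ᴬ_ : A → A → Set) (_⊕_ : A → A → A) (𝟎 : A) (_•_ : Carrier → A → A) →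
    IsEquivalence _≈ᴬ_ →
    (∀ {x y u v} → x ≈ᴬ y → u ≈ᴬ v → (x ⊕ u) ≈ᴬ (y ⊕ v)) →
    (∀ x y z → ((x ⊕ y) ⊕ z) ≈ᴬ (x ⊕ (y ⊕ z))) →
    (∀ x y → (x ⊕ y) ≈ᴬ (y ⊕ x)) →
    (∀ x → (𝟎 ⊕ x) ≈ᴬ x) →
    (∀ {r s x y} → r ≈ s → x ≈ᴬ y → (r • x) ≈ᴬ (s • y)) →
    (∀ x → (0# • x) ≈ᴬ 𝟎) →
    (∀ r → (r • 𝟎) ≈ᴬ 𝟎) →
    (∀ x r s → ((r + s) • x) ≈ᴬ ((r • x) ⊕ (s • x))) →
    (∀ r x y → (r • (x ⊕ y)) ≈ᴬ ((r • x) ⊕ (r • y))) →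
    (∀ x → (1# • x) ≈ᴬ x) →
    (∀ r s x → ((r * s) • x) ≈ᴬ (r • (s • x))) →
    Mod R
  mkModule A _≈ᴬ_ _⊕_ 𝟎 _•_ eq ⊕-cong ⊕-assoc ⊕-comm ⊕-idˡ •-cong •-zeroˡ •-zeroʳ •-dʳ •-dˡ •-id •-assoc = record
    { Carrierᴹ = A
    ; _≈ᴹ_ = _≈ᴬ_
    ; _+ᴹ_ = _⊕_
    ; _*ₗ_ = _•_
    ; _*ᵣ_ = λ x r → r • x
    ; 0ᴹ = 𝟎
    ; -ᴹ_ = neg
    ; isModule = IsModuleFromLeft.isModule {commutativeRing = R} (record { isLeftModule = record
        { isLeftSemimodule = record
          { +ᴹ-isCommutativeMonoid = record
            { isMonoid = record
              { isSemigroup = record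
                { isMagma = record { isEquivalence = eq ; ∙-cong = ⊕-cong }
                ; assoc = ⊕-assoc }
              ; identity = ⊕-idˡ , λ x → E.trans (⊕-comm x 𝟎) (⊕-idˡ x) }
            ; comm = ⊕-comm }
          ; isPreleftSemimodule = record
            { *ₗ-cong = •-cong
            ; *ₗ-zeroˡ = •-zeroˡ
            ; *ₗ-distribʳ = •-dʳ
            ; *ₗ-identityˡ = •-id
            ; *ₗ-assoc = •-assoc
            ; *ₗ-zeroʳ = •-zeroʳ
            ; *ₗ-distribˡ = •-dˡ } }
        ; -ᴹ‿cong = •-cong refl
        ; -ᴹ‿inverse = inverseˡ , λ x → E.trans (⊕-comm x (neg x)) (inverseˡ x) } })
    }
    where
    module E = IsEquivalence eq
    neg : A → A
    neg x = (- 1#) • x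
    inverseˡ : ∀ x → (neg x ⊕ x) ≈ᴬ 𝟎
    inverseˡ x = E.trans (⊕-cong E.refl (E.sym (•-id x)))
      (E.trans (E.sym (•-dʳ x (- 1#) 1#)) (E.trans (•-cong (-‿inverseˡ 1#) E.refl) (•-zeroˡ x)))

module LinearAlgebra {R : CRing} (V : Mod R) where
  open CommutativeRing R hiding (zero)
  open Module V
  open import Algebra.Properties.Monoid.Sum +ᴹ-monoid public using () renaming (sum to ∑)

  combination : ∀ {n} → Vector Carrier n → Vector Carrierᴹ n → Carrierᴹ
  combination c v = ∑ (λ j → c j *ₗ v j)

  LinearlyIndependent : ∀ {n} → Vector Carrierᴹ n → Set
  LinearlyIndependent v = ∀ c → combination c v ≈ᴹ 0ᴹ → ∀ j → c j ≈ 0#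

  Spanning : ∀ {n} → Vector Carrierᴹ n → Set
  Spanning {n} v = ∀ x → Σ (Vector Carrier n) λ c → x ≈ᴹ combination c v

  IsBasis : ∀ {n} → Vector Carrierᴹ n → Set
  IsBasis v = LinearlyIndependent v × Spanning v

  HasDimension : ℕ → Set
  HasDimension n = Σ (Vector Carrierᴹ n) IsBasis

  FiniteDimensional : Set
  FiniteDimensional = ∃ HasDimension

  record Submodule : Set₁ where
    field
      member    : Pred Carrierᴹ 0ℓ
      resp      : ∀ {x y} → x ≈ᴹ y → member x → member y
      0-closed  : member 0ᴹ
      +-closed  : ∀ {x y} → member x → member y → member (x +ᴹ y)
      *ₗ-closed : ∀ r {x} → member x → member (r *ₗ x)

  open Submodule

  subModule : Submodule → Mod R
  subModule W = mkModule (Σ Carrierᴹ (member W))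
    (λ x y → proj₁ x ≈ᴹ proj₁ y)
    (λ x y → proj₁ x +ᴹ proj₁ y , +-closed W (proj₂ x) (proj₂ y))
    (0ᴹ , 0-closed W)
    (λ r x → r *ₗ proj₁ x , *ₗ-closed W r (proj₂ x))
    (record { refl = ≈ᴹ-refl ; sym = ≈ᴹ-sym ; trans = ≈ᴹ-trans })
    +ᴹ-cong
    (λ x y z → +ᴹ-assoc _ _ _)
    (λ x y → +ᴹ-comm _ _)
    (λ x → +ᴹ-identityˡ _)
    *ₗ-cong
    (λ x → *ₗ-zeroˡ _)
    *ₗ-zeroʳ
    (λ x → *ₗ-distribʳ (proj₁ x))
    (λ r x y → *ₗ-distribˡ r (proj₁ x) (proj₁ y))
    (λ x → *ₗ-identityˡ (proj₁ x))
    (λ r s x → *ₗ-assoc r s (proj₁ x))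
    where open MakeModule R

  -- V / W: the carrier of V, with x and y identified when x = y + w for some w in W.
  quotient : Submodule → Mod R
  quotient W = mkModule Carrierᴹ _~_ _+ᴹ_ 0ᴹ _*ₗ_
    (record { refl = ≈⇒~ ≈ᴹ-refl ; sym = ~-sym ; trans = ~-trans })
    (λ { {x} {y} {u} {v} (w , w∈ , p) (z , z∈ , q) →
        w +ᴹ z , +-closed W w∈ z∈ , ≈ᴹ-trans (+ᴹ-cong p q) (interchange y w v z) })
    (λ x y z → ≈⇒~ (+ᴹ-assoc x y z))
    (λ x y → ≈⇒~ (+ᴹ-comm x y))
    (λ x → ≈⇒~ (+ᴹ-identityˡ x))
    (λ { {r} {s} {x} {y} r≈s (w , w∈ , p) →
        r *ₗ w , *ₗ-closed W r w∈ ,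
        ≈ᴹ-trans (*ₗ-congˡ p) (≈ᴹ-trans (*ₗ-distribˡ r y w) (+ᴹ-congʳ (*ₗ-congʳ r≈s))) })
    (λ x → ≈⇒~ (*ₗ-zeroˡ x))
    (λ r → ≈⇒~ (*ₗ-zeroʳ r))
    (λ x r s → ≈⇒~ (*ₗ-distribʳ x r s))
    (λ r x y → ≈⇒~ (*ₗ-distribˡ r x y))
    (λ x → ≈⇒~ (*ₗ-identityˡ x))
    (λ r s x → ≈⇒~ (*ₗ-assoc r s x))
    where
    open MakeModule R
    open import Algebra.Properties.CommutativeSemigroup
      (CommutativeMonoid.commutativeSemigroup +ᴹ-commutativeMonoid) using (interchange)
    _~_ : Carrierᴹ → Carrierᴹ → Set
    x ~ y = Σ Carrierᴹ λ w → member W w × x ≈ᴹ y +ᴹ w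
    ≈⇒~ : ∀ {x y} → x ≈ᴹ y → x ~ y
    ≈⇒~ p = 0ᴹ , 0-closed W , ≈ᴹ-trans p (≈ᴹ-sym (+ᴹ-identityʳ _))
    ~-sym : ∀ {x y} → x ~ y → y ~ x
    ~-sym {x} {y} (w , w∈ , p) = (- 1#) *ₗ w , *ₗ-closed W (- 1#) w∈ ,
      ≈ᴹ-sym (≈ᴹ-trans (+ᴹ-congʳ p) (≈ᴹ-trans (+ᴹ-assoc y w _)
        (≈ᴹ-trans (+ᴹ-congˡ cancel) (+ᴹ-identityʳ y))))
      where
      cancel : w +ᴹ (- 1#) *ₗ w ≈ᴹ 0ᴹ
      cancel = ≈ᴹ-trans (+ᴹ-congʳ (≈ᴹ-sym (*ₗ-identityˡ w)))
        (≈ᴹ-trans (≈ᴹ-sym (*ₗ-distribʳ w 1# (- 1#)))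
          (≈ᴹ-trans (*ₗ-congʳ (-‿inverseʳ 1#)) (*ₗ-zeroˡ w)))
    ~-trans : ∀ {x y z} → x ~ y → y ~ z → x ~ z
    ~-trans (w , w∈ , p) (w′ , w′∈ , q) = w′ +ᴹ w , +-closed W w′∈ w∈ ,
      ≈ᴹ-trans p (≈ᴹ-trans (+ᴹ-congʳ q) (+ᴹ-assoc _ _ _))

  -- x lies in the sum of the submodules W i over the i satisfying J.
  SumOver : {I : Set} → (I → Submodule) → Pred I 0ℓ → Pred Carrierᴹ 0ℓ
  SumOver {I} W J x =
    Σ ℕ λ n → Σ (Vector I n) λ i → Σ (Vector Carrierᴹ n) λ v →
    (∀ k → J (i k)) × (∀ k → member (W (i k)) (v k)) × x ≈ᴹ ∑ v

  record IsDirectSum {I : Set} (W : I → Submodule) : Set where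
    field
      spans       : ∀ x → SumOver W U x
      independent : ∀ {n} (i : Vector I n) → Injective _≡_ _≡_ i →
                    (v : Vector Carrierᴹ n) → (∀ k → member (W (i k)) (v k)) →
                    ∑ v ≈ᴹ 0ᴹ → ∀ k → v k ≈ᴹ 0ᴹ

open LinearAlgebra using (Submodule; subModule; quotient; HasDimension; FiniteDimensional)

_∈ˢ_ : {R : CRing} {V : Mod R} → Module.Carrierᴹ V → Submodule V → Set
x ∈ˢ W = Submodule.member W x

LinearMap : {R : CRing} (V W : Mod R) → (Module.Carrierᴹ V → Module.Carrierᴹ W) → Set
LinearMap V W f = IsModuleHomomorphism (Module.rawModule V) (Module.rawModule W) f

LinearIso : {R : CRing} (V W : Mod R) → (Module.Carrierᴹ V → Module.Carrierᴹ W) → Set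
LinearIso V W f = IsModuleIsomorphism (Module.rawModule V) (Module.rawModule W) f

module _ {R : CRing} (V W : Mod R) where
  private
    module R = CommutativeRing R
    module V = Module V
    module W = Module W
    open import Algebra.Properties.AbelianGroup W.+ᴹ-abelianGroup using (inverseˡ-unique; ⁻¹-∙-comm)

  mkLinear : (f : V.Carrierᴹ → W.Carrierᴹ) →
    (∀ {x y} → x V.≈ᴹ y → f x W.≈ᴹ f y) →
    (∀ x y → f (x V.+ᴹ y) W.≈ᴹ f x W.+ᴹ f y) →
    (∀ r x → f (r V.*ₗ x) W.≈ᴹ r W.*ₗ f x) →
    LinearMap V W f
  mkLinear f f-cong f-+ f-* = record { isBimoduleHomomorphism = record
    { +ᴹ-isGroupHomomorphism = record
      { isMonoidHomomorphism = record
        { isMagmaHomomorphism = record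
          { isRelHomomorphism = record { cong = f-cong } ; homo = f-+ }
        ; ε-homo = f-0 }
      ; ⁻¹-homo = λ x → inverseˡ-unique _ _
          (W.≈ᴹ-trans (W.≈ᴹ-sym (f-+ _ _)) (W.≈ᴹ-trans (f-cong (V.-ᴹ‿inverseˡ x)) f-0)) }
    ; *ₗ-homo = f-*
    ; *ᵣ-homo = λ r x → W.≈ᴹ-trans (f-cong (V.≈ᴹ-sym (V.*ₗ-*ᵣ-coincident r x)))
        (W.≈ᴹ-trans (f-* r x) (W.*ₗ-*ᵣ-coincident r (f x))) } }
    where
    f-0 : f V.0ᴹ W.≈ᴹ W.0ᴹ
    f-0 = W.≈ᴹ-trans (f-cong (V.≈ᴹ-sym (V.*ₗ-zeroˡ V.0ᴹ)))
      (W.≈ᴹ-trans (f-* R.0# V.0ᴹ) (W.*ₗ-zeroˡ _))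

  negate-linear : ∀ {f} → LinearMap V W f → LinearMap V W (λ x → W.-ᴹ f x)
  negate-linear {f} f-linear = mkLinear _
    (λ p → W.-ᴹ‿cong (⟦⟧-cong p))
    (λ x y → W.≈ᴹ-trans (W.-ᴹ‿cong (+ᴹ-homo x y)) (W.≈ᴹ-sym (⁻¹-∙-comm _ _)))
    (λ r x → W.≈ᴹ-trans (W.-ᴹ‿cong (*ₗ-homo r x)) (W.≈ᴹ-sym (inverseˡ-unique _ _
      (W.≈ᴹ-trans (W.≈ᴹ-sym (W.*ₗ-distribˡ r _ _))
        (W.≈ᴹ-trans (W.*ₗ-congˡ (W.-ᴹ‿inverseˡ (f x))) (W.*ₗ-zeroʳ r))))))
    where open IsModuleHomomorphism f-linear

  scale-iso : ∀ {f} (u u⁻¹ : R.Carrier) → u R.* u⁻¹ R.≈ R.1# →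
    LinearIso V W f → LinearIso V W (λ x → u W.*ₗ f x)
  scale-iso {f} u u⁻¹ inv f-iso = record
    { isModuleMonomorphism = record
      { isModuleHomomorphism = mkLinear _
          (λ p → W.*ₗ-congˡ (⟦⟧-cong p))
          (λ x y → W.≈ᴹ-trans (W.*ₗ-congˡ (+ᴹ-homo x y)) (W.*ₗ-distribˡ u _ _))
          (λ r x → W.≈ᴹ-trans (W.*ₗ-congˡ (*ₗ-homo r x)) (W.≈ᴹ-trans (W.≈ᴹ-sym (W.*ₗ-assoc u r _))
            (W.≈ᴹ-trans (W.*ₗ-congʳ (R.*-comm u r)) (W.*ₗ-assoc r u _))))
      ; injective = λ {x} {y} p → injective (W.≈ᴹ-trans (W.≈ᴹ-sym (undo (f x)))
          (W.≈ᴹ-trans (W.*ₗ-congˡ p) (undo (f y)))) }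
    ; surjective = λ y → proj₁ (surjective (u⁻¹ W.*ₗ y)) , λ q →
        W.≈ᴹ-trans (W.*ₗ-congˡ (proj₂ (surjective (u⁻¹ W.*ₗ y)) q)) (redo y) }
    where
    open IsModuleIsomorphism f-iso using (surjective; isModuleMonomorphism)
    open import Algebra.Module.Morphism.Structures using (IsModuleMonomorphism)
    open IsModuleMonomorphism isModuleMonomorphism using (injective; isModuleHomomorphism)
    open IsModuleHomomorphism isModuleHomomorphism using (⟦⟧-cong; +ᴹ-homo; *ₗ-homo)
    undo : ∀ w → u⁻¹ W.*ₗ (u W.*ₗ w) W.≈ᴹ w
    undo w = W.≈ᴹ-trans (W.≈ᴹ-sym (W.*ₗ-assoc _ _ _))
      (W.≈ᴹ-trans (W.*ₗ-congʳ (R.trans (R.*-comm _ _) inv)) (W.*ₗ-identityˡ w))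
    redo : ∀ w → u W.*ₗ (u⁻¹ W.*ₗ w) W.≈ᴹ w
    redo w = W.≈ᴹ-trans (W.≈ᴹ-sym (W.*ₗ-assoc _ _ _))
      (W.≈ᴹ-trans (W.*ₗ-congʳ inv) (W.*ₗ-identityˡ w))

fixedSpace : {R : CRing} (V : Mod R) (f : Module.Carrierᴹ V → Module.Carrierᴹ V) → LinearMap V V f → Submodule V
fixedSpace V f f-linear = record
  { member = λ x → f x ≈ᴹ x
  ; resp = λ p q → ≈ᴹ-trans (⟦⟧-cong (≈ᴹ-sym p)) (≈ᴹ-trans q p)
  ; 0-closed = 0ᴹ-homo
  ; +-closed = λ p q → ≈ᴹ-trans (+ᴹ-homo _ _) (+ᴹ-cong p q)
  ; *ₗ-closed = λ r p → ≈ᴹ-trans (*ₗ-homo r _) (*ₗ-congˡ p)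
  }
  where
  open Module V
  open IsModuleHomomorphism f-linear

-- Extension of scalars V ⊗_R S along φ : R → S, as formal sums of v ⊗ c modulo
-- the relations defining the tensor product.
module BaseChange (R S : CRing) (φ : RingHom R S) (V : Mod R) where
  private
    module R = CommutativeRing R
    module S = CommutativeRing S
    module V = Module V
    module φ = RingHomomorphism φ

  infixl 7 _⊗_
  infixl 6 _⊕_
  infix 4 _≈⊗_

  data Tensor : Set where
    𝟎   : Tensor
    _⊗_ : V.Carrierᴹ → S.Carrier → Tensor
    _⊕_ : Tensor → Tensor → Tensor

  data _≈⊗_ : Tensor → Tensor → Set where
    reflᵗ     : ∀ {x} → x ≈⊗ x
    symᵗ      : ∀ {x y} → x ≈⊗ y → y ≈⊗ x
    transᵗ    : ∀ {x y z} → x ≈⊗ y → y ≈⊗ z → x ≈⊗ z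
    ⊕-cong    : ∀ {x y u v} → x ≈⊗ y → u ≈⊗ v → x ⊕ u ≈⊗ y ⊕ v
    ⊕-assoc   : ∀ x y z → (x ⊕ y) ⊕ z ≈⊗ x ⊕ (y ⊕ z)
    ⊕-comm    : ∀ x y → x ⊕ y ≈⊗ y ⊕ x
    ⊕-idˡ     : ∀ x → 𝟎 ⊕ x ≈⊗ x
    ⊗-cong    : ∀ {v w c d} → v V.≈ᴹ w → c S.≈ d → v ⊗ c ≈⊗ w ⊗ d
    ⊗-zeroʳ   : ∀ v → v ⊗ S.0# ≈⊗ 𝟎
    ⊗-distˡ   : ∀ v c d → v ⊗ (c S.+ d) ≈⊗ v ⊗ c ⊕ v ⊗ d
    ⊗-distʳ   : ∀ v w c → (v V.+ᴹ w) ⊗ c ≈⊗ v ⊗ c ⊕ w ⊗ c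
    ⊗-balance : ∀ r v c → (r V.*ₗ v) ⊗ c ≈⊗ v ⊗ (φ.⟦ r ⟧ S.* c)

  _•_ : S.Carrier → Tensor → Tensor
  s • 𝟎       = 𝟎
  s • (v ⊗ c) = v ⊗ (s S.* c)
  s • (x ⊕ y) = s • x ⊕ s • y

  private
    •-congʳ : ∀ {r s} x → r S.≈ s → r • x ≈⊗ s • x
    •-congʳ 𝟎 p = reflᵗ
    •-congʳ (v ⊗ c) p = ⊗-cong V.≈ᴹ-refl (S.*-congʳ p)
    •-congʳ (x ⊕ y) p = ⊕-cong (•-congʳ x p) (•-congʳ y p)

    •-congˡ : ∀ s {x y} → x ≈⊗ y → s • x ≈⊗ s • y
    •-congˡ s reflᵗ = reflᵗ
    •-congˡ s (symᵗ p) = symᵗ (•-congˡ s p)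
    •-congˡ s (transᵗ p q) = transᵗ (•-congˡ s p) (•-congˡ s q)
    •-congˡ s (⊕-cong p q) = ⊕-cong (•-congˡ s p) (•-congˡ s q)
    •-congˡ s (⊕-assoc x y z) = ⊕-assoc _ _ _
    •-congˡ s (⊕-comm x y) = ⊕-comm _ _
    •-congˡ s (⊕-idˡ x) = ⊕-idˡ _
    •-congˡ s (⊗-cong p q) = ⊗-cong p (S.*-congˡ q)
    •-congˡ s (⊗-zeroʳ v) = transᵗ (⊗-cong V.≈ᴹ-refl (S.zeroʳ s)) (⊗-zeroʳ v)
    •-congˡ s (⊗-distˡ v c d) = transᵗ (⊗-cong V.≈ᴹ-refl (S.distribˡ s c d)) (⊗-distˡ v _ _)
    •-congˡ s (⊗-distʳ v w c) = ⊗-distʳ v w _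
    •-congˡ s (⊗-balance r v c) = transᵗ (⊗-balance r v (s S.* c)) (⊗-cong V.≈ᴹ-refl
      (S.trans (S.sym (S.*-assoc _ _ _)) (S.trans (S.*-congʳ (S.*-comm _ _)) (S.*-assoc _ _ _))))

    interchangeᵗ : ∀ a b c d → (a ⊕ b) ⊕ (c ⊕ d) ≈⊗ (a ⊕ c) ⊕ (b ⊕ d)
    interchangeᵗ a b c d = transᵗ (⊕-assoc a b (c ⊕ d)) (transᵗ (⊕-cong reflᵗ
      (transᵗ (symᵗ (⊕-assoc b c d)) (transᵗ (⊕-cong (⊕-comm b c) reflᵗ) (⊕-assoc c b d))))
      (symᵗ (⊕-assoc a c (b ⊕ d))))

    •-zeroˡ : ∀ x → S.0# • x ≈⊗ 𝟎
    •-zeroˡ 𝟎 = reflᵗ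
    •-zeroˡ (v ⊗ c) = transᵗ (⊗-cong V.≈ᴹ-refl (S.zeroˡ c)) (⊗-zeroʳ v)
    •-zeroˡ (x ⊕ y) = transᵗ (⊕-cong (•-zeroˡ x) (•-zeroˡ y)) (⊕-idˡ 𝟎)

    •-distribʳ : ∀ x r s → (r S.+ s) • x ≈⊗ r • x ⊕ s • x
    •-distribʳ 𝟎 r s = symᵗ (⊕-idˡ 𝟎)
    •-distribʳ (v ⊗ c) r s = transᵗ (⊗-cong V.≈ᴹ-refl (S.distribʳ c r s)) (⊗-distˡ v _ _)
    •-distribʳ (x ⊕ y) r s = transᵗ (⊕-cong (•-distribʳ x r s) (•-distribʳ y r s)) (interchangeᵗ _ _ _ _)

    •-identity : ∀ x → S.1# • x ≈⊗ x
    •-identity 𝟎 = reflᵗ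
    •-identity (v ⊗ c) = ⊗-cong V.≈ᴹ-refl (S.*-identityˡ c)
    •-identity (x ⊕ y) = ⊕-cong (•-identity x) (•-identity y)

    •-assoc : ∀ r s x → (r S.* s) • x ≈⊗ r • (s • x)
    •-assoc r s 𝟎 = reflᵗ
    •-assoc r s (v ⊗ c) = ⊗-cong V.≈ᴹ-refl (S.*-assoc r s c)
    •-assoc r s (x ⊕ y) = ⊕-cong (•-assoc r s x) (•-assoc r s y)

  tensorModule : Mod S
  tensorModule = MakeModule.mkModule S Tensor _≈⊗_ _⊕_ 𝟎 _•_
    (record { refl = reflᵗ ; sym = symᵗ ; trans = transᵗ })
    ⊕-cong ⊕-assoc ⊕-comm ⊕-idˡ
    (λ {r} {s} {x} {y} p q → transᵗ (•-congʳ x p) (•-congˡ s q))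
    •-zeroˡ (λ r → reflᵗ) •-distribʳ (λ r x y → reflᵗ) •-identity •-assoc

  _⊗ˢ : Submodule V → Pred Tensor 0ℓ
  (W ⊗ˢ) x = Σ ℕ λ n → Σ (Vector V.Carrierᴹ n) λ v → Σ (Vector S.Carrier n) λ c →
    (∀ k → v k ∈ˢ W) × x ≈⊗ LinearAlgebra.∑ tensorModule (λ k → v k ⊗ c k)

  ⊗ˢ-resp : ∀ W {x y} → x ≈⊗ y → (W ⊗ˢ) x → (W ⊗ˢ) y
  ⊗ˢ-resp W p (n , v , c , v∈ , q) = n , v , c , v∈ , transᵗ (symᵗ p) q

  ⊗ˢ-scale : ∀ W s {x} → (W ⊗ˢ) x → (W ⊗ˢ) (s • x)
  ⊗ˢ-scale W s (n , v , c , v∈ , q) =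
    n , v , (λ k → s S.* c k) , v∈ , transᵗ (•-congˡ s q) (go v c)
    where
    go : ∀ {n} (v : Vector V.Carrierᴹ n) (c : Vector S.Carrier n) →
         s • LinearAlgebra.∑ tensorModule (λ k → v k ⊗ c k) ≈⊗ LinearAlgebra.∑ tensorModule (λ k → v k ⊗ (s S.* c k))
    go {zero}  v c = reflᵗ
    go {suc n} v c = ⊕-cong reflᵗ (go (v ∘ suc) (c ∘ suc))

  _⊗id : (V.Carrierᴹ → V.Carrierᴹ) → Tensor → Tensor
  (f ⊗id) 𝟎       = 𝟎
  (f ⊗id) (v ⊗ c) = f v ⊗ c
  (f ⊗id) (x ⊕ y) = (f ⊗id) x ⊕ (f ⊗id) y

  ⊗id-negate : ∀ f x → ((λ v → V.-ᴹ f v) ⊗id) x ≈⊗ (S.- S.1#) • (f ⊗id) x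
  ⊗id-negate f 𝟎 = reflᵗ
  ⊗id-negate f (v ⊗ c) = transᵗ (⊗-cong (V.≈ᴹ-sym (inverseˡ-unique _ _ -1*v+v≈0)) S.refl)
    (transᵗ (⊗-balance _ _ _) (⊗-cong V.≈ᴹ-refl (S.*-congʳ (S.trans (φ.-‿homo _) (S.-‿cong φ.1#-homo)))))
    where
    open import Algebra.Properties.AbelianGroup V.+ᴹ-abelianGroup using (inverseˡ-unique)
    -1*v+v≈0 : (R.- R.1#) V.*ₗ f v V.+ᴹ f v V.≈ᴹ V.0ᴹ
    -1*v+v≈0 = V.≈ᴹ-trans (V.+ᴹ-congˡ (V.≈ᴹ-sym (V.*ₗ-identityˡ _)))
      (V.≈ᴹ-trans (V.≈ᴹ-sym (V.*ₗ-distribʳ _ _ _))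
        (V.≈ᴹ-trans (V.*ₗ-congʳ (R.-‿inverseˡ R.1#)) (V.*ₗ-zeroˡ _)))
  ⊗id-negate f (x ⊕ y) = ⊕-cong (⊗id-negate f x) (⊗id-negate f y)

  extend : (V.Carrierᴹ → R.Carrier) → Tensor → S.Carrier
  extend f 𝟎       = S.0#
  extend f (v ⊗ c) = φ.⟦ f v ⟧ S.* c
  extend f (x ⊕ y) = extend f x S.+ extend f y

  extend-cong : ∀ (f : V.Carrierᴹ → R.Carrier) →
    (∀ {v w} → v V.≈ᴹ w → f v R.≈ f w) →
    (∀ v w → f (v V.+ᴹ w) R.≈ f v R.+ f w) →
    (∀ r v → f (r V.*ₗ v) R.≈ r R.* f v) →
    ∀ {x y} → x ≈⊗ y → extend f x S.≈ extend f y
  extend-cong f f-cong f-+ f-* = go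
    where
    go : ∀ {x y} → x ≈⊗ y → extend f x S.≈ extend f y
    go reflᵗ = S.refl
    go (symᵗ p) = S.sym (go p)
    go (transᵗ p q) = S.trans (go p) (go q)
    go (⊕-cong p q) = S.+-cong (go p) (go q)
    go (⊕-assoc x y z) = S.+-assoc _ _ _
    go (⊕-comm x y) = S.+-comm _ _
    go (⊕-idˡ x) = S.+-identityˡ _
    go (⊗-cong p q) = S.*-cong (φ.⟦⟧-cong (f-cong p)) q
    go (⊗-zeroʳ v) = S.zeroʳ _
    go (⊗-distˡ v c d) = S.distribˡ _ _ _
    go (⊗-distʳ v w c) = S.trans
      (S.*-congʳ (S.trans (φ.⟦⟧-cong (f-+ v w)) (φ.+-homo _ _))) (S.distribʳ _ _ _)
    go (⊗-balance r v c) = S.trans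
      (S.*-congʳ (S.trans (φ.⟦⟧-cong (f-* r v)) (S.trans (φ.*-homo _ _) (S.*-comm _ _))))
      (S.*-assoc _ _ _)

module IntegerCast (R : CRing) where
  open CommutativeRing R hiding (zero)
  open import Algebra.Properties.Semiring.Mult semiring using (×-homo-+; ×1-homo-*) renaming (_×_ to _·_)
  open import Algebra.Properties.Ring ring
  open import Algebra.Properties.AbelianGroup +-abelianGroup using () renaming (⁻¹-∙-comm to -‿+-comm′)
  open import Relation.Binary.Reasoning.Setoid setoid

  fromℤ : ℤ → Carrier
  fromℤ (+ n)    = n · 1#
  fromℤ -[1+ n ] = - (suc n · 1#)

  private
    ⊖-homo : ∀ m n → fromℤ (m ℤ.⊖ n) ≈ m · 1# - n · 1#
    ⊖-homo zero zero = sym (-‿inverseʳ 0#)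
    ⊖-homo zero (suc n) = sym (+-identityˡ _)
    ⊖-homo (suc m) zero = sym (trans (+-congˡ -0#≈0#) (+-identityʳ _))
    ⊖-homo (suc m) (suc n) = begin
      fromℤ (suc m ℤ.⊖ suc n)          ≡⟨ ≡.cong fromℤ (ℤₚ.[1+m]⊖[1+n]≡m⊖n m n) ⟩
      fromℤ (m ℤ.⊖ n)                  ≈⟨ ⊖-homo m n ⟩
      a - b                            ≈⟨ +-identityˡ _ ⟨
      0# + (a - b)                     ≈⟨ +-congʳ (-‿inverseʳ 1#) ⟨
      (1# - 1#) + (a - b)              ≈⟨ +-assoc _ _ _ ⟩
      1# + (- 1# + (a - b))            ≈⟨ +-congˡ (+-assoc _ _ _) ⟨
      1# + ((- 1# + a) - b)            ≈⟨ +-congˡ (+-congʳ (+-comm _ _)) ⟩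
      1# + ((a - 1#) - b)              ≈⟨ +-congˡ (+-assoc _ _ _) ⟩
      1# + (a + (- 1# - b))            ≈⟨ +-assoc _ _ _ ⟨
      (1# + a) + (- 1# - b)            ≈⟨ +-congˡ (-‿+-comm′ _ _) ⟩
      (1# + a) - (1# + b)              ∎
      where
      a = m · 1#
      b = n · 1#

    +-homo : ∀ x y → fromℤ (x ℤ.+ y) ≈ fromℤ x + fromℤ y
    +-homo (+ m) (+ n) = ×-homo-+ 1# m n
    +-homo (+ m) -[1+ n ] = ⊖-homo m (suc n)
    +-homo -[1+ m ] (+ n) = trans (⊖-homo n (suc m)) (+-comm _ _)
    +-homo -[1+ m ] -[1+ n ] = begin
      - (suc (suc (m ℕ.+ n)) · 1#)     ≡⟨ ≡.cong (λ k → - (k · 1#)) (≡.cong suc (ℕₚ.+-suc m n)) ⟨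
      - ((suc m ℕ.+ suc n) · 1#)       ≈⟨ -‿cong (×-homo-+ 1# (suc m) (suc n)) ⟩
      - (suc m · 1# + suc n · 1#)      ≈⟨ -‿+-comm′ _ _ ⟨
      - (suc m · 1#) - (suc n · 1#)    ∎

    neg-homo : ∀ x → fromℤ (ℤ.- x) ≈ - fromℤ x
    neg-homo (+ zero) = sym -0#≈0#
    neg-homo (+ suc n) = refl
    neg-homo -[1+ n ] = sym (-‿involutive _)

    *-homo⁺ : ∀ m n → fromℤ (+ m ℤ.* + n) ≈ fromℤ (+ m) * fromℤ (+ n)
    *-homo⁺ m n = trans (reflexive (≡.cong fromℤ (≡.sym (ℤₚ.pos-* m n)))) (×1-homo-* m n)

    *-homo : ∀ x y → fromℤ (x ℤ.* y) ≈ fromℤ x * fromℤ y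
    *-homo (+ m) (+ n) = *-homo⁺ m n
    *-homo (+ m) -[1+ n ] = begin
      fromℤ (+ m ℤ.* -[1+ n ])         ≡⟨ ≡.cong fromℤ (ℤₚ.neg-distribʳ-* (+ m) (+ suc n)) ⟨
      fromℤ (ℤ.- (+ m ℤ.* + suc n))    ≈⟨ neg-homo (+ m ℤ.* + suc n) ⟩
      - fromℤ (+ m ℤ.* + suc n)        ≈⟨ -‿cong (*-homo⁺ m (suc n)) ⟩
      - (m · 1# * (suc n · 1#))        ≈⟨ -‿distribʳ-* _ _ ⟩
      m · 1# * - (suc n · 1#)          ∎
    *-homo -[1+ m ] (+ n) = begin
      fromℤ (-[1+ m ] ℤ.* + n)         ≡⟨ ≡.cong fromℤ (ℤₚ.neg-distribˡ-* (+ suc m) (+ n)) ⟨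
      fromℤ (ℤ.- (+ suc m ℤ.* + n))    ≈⟨ neg-homo (+ suc m ℤ.* + n) ⟩
      - fromℤ (+ suc m ℤ.* + n)        ≈⟨ -‿cong (*-homo⁺ (suc m) n) ⟩
      - (suc m · 1# * (n · 1#))        ≈⟨ -‿distribˡ-* _ _ ⟩
      - (suc m · 1#) * (n · 1#)        ∎
    *-homo -[1+ m ] -[1+ n ] = begin
      fromℤ (-[1+ m ] ℤ.* -[1+ n ])    ≡⟨⟩
      fromℤ (+ suc m ℤ.* + suc n)      ≈⟨ *-homo⁺ (suc m) (suc n) ⟩
      suc m · 1# * (suc n · 1#)        ≈⟨ -‿involutive _ ⟨
      - - (suc m · 1# * (suc n · 1#))  ≈⟨ -‿cong (-‿distribʳ-* _ _) ⟩
      - (suc m · 1# * - (suc n · 1#))  ≈⟨ -‿distribˡ-* _ _ ⟩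
      - (suc m · 1#) * - (suc n · 1#)  ∎

  fromℤ-hom : RingHom ℤₚ.+-*-commutativeRing R
  fromℤ-hom = record
    { ⟦_⟧ = fromℤ
    ; isRingHomomorphism = record
      { isSemiringHomomorphism = record
        { isNearSemiringHomomorphism = record
          { +-isMonoidHomomorphism = record
            { isMagmaHomomorphism = record
              { isRelHomomorphism = record { cong = λ p → reflexive (≡.cong fromℤ p) }
              ; homo = +-homo }
            ; ε-homo = refl }
          ; *-homo = *-homo }
        ; 1#-homo = +-identityʳ 1# }
      ; -‿homo = neg-homo } }

-- A solver for identities in a commutative ring, normalising with coefficients in ℤ.
module CRingSolver (R : CRing) where
  open CommutativeRing R
  open IntegerCast R
  private
    module F = RingHomomorphism fromℤ-hom
    A : AlmostCommutativeRing 0ℓ 0ℓ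
    A = fromCommutativeRing R
    ℤ⟶R : CommutativeRing.rawRing ℤₚ.+-*-commutativeRing -Raw-AlmostCommutative⟶ A
    ℤ⟶R = record
      { ⟦_⟧ = fromℤ
      ; +-homo = F.+-homo
      ; *-homo = F.*-homo
      ; -‿homo = F.-‿homo
      ; 0-homo = refl
      ; 1-homo = F.1#-homo }
    _coeff≟_ : ∀ x y → Maybe (fromℤ x ≈ fromℤ y)
    x coeff≟ y with x ℤₚ.≟ y
    ... | yes ≡.refl = just refl
    ... | no _       = nothing
  open Algebra.Solver.Ring (CommutativeRing.rawRing ℤₚ.+-*-commutativeRing) A ℤ⟶R _coeff≟_ public

module ComplexNumbers (R : CRing) where
  open CommutativeRing R
  open CRingSolver R using (solve; _:=_; _:+_; _:*_; _:-_)
  open import Algebra.Properties.Ring ring using (-0#≈0#)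

  ℂ-Carrier : Set
  ℂ-Carrier = Carrier × Carrier

  _≈ᶜ_ : ℂ-Carrier → ℂ-Carrier → Set
  (a , b) ≈ᶜ (c , d) = a ≈ c × b ≈ d

  _+ᶜ_ _*ᶜ_ : ℂ-Carrier → ℂ-Carrier → ℂ-Carrier
  (a , b) +ᶜ (c , d) = a + c , b + d
  (a , b) *ᶜ (c , d) = a * c - b * d , a * d + b * c

  private
    assoc-re : ∀ a b c d e f → (a * c - b * d) * e - (a * d + b * c) * f ≈ a * (c * e - d * f) - b * (c * f + d * e)
    assoc-re = solve 6 (λ a b c d e f → (a :* c :- b :* d) :* e :- (a :* d :+ b :* c) :* f := a :* (c :* e :- d :* f) :- b :* (c :* f :+ d :* e)) refl
    assoc-im : ∀ a b c d e f → (a * c - b * d) * f + (a * d + b * c) * e ≈ a * (c * f + d * e) + b * (c * e - d * f)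
    assoc-im = solve 6 (λ a b c d e f → (a :* c :- b :* d) :* f :+ (a :* d :+ b :* c) :* e := a :* (c :* f :+ d :* e) :+ b :* (c :* e :- d :* f)) refl
    comm-im : ∀ a b c d → a * d + b * c ≈ c * b + d * a
    comm-im = solve 4 (λ a b c d → a :* d :+ b :* c := c :* b :+ d :* a) refl
    comm-re : ∀ a b c d → a * c - b * d ≈ c * a - d * b
    comm-re = solve 4 (λ a b c d → a :* c :- b :* d := c :* a :- d :* b) refl
    id-re : ∀ a b → 1# * a - 0# * b ≈ a
    id-re a b = trans (+-cong (*-identityˡ a) (trans (-‿cong (zeroˡ b)) -0#≈0#)) (+-identityʳ a)
    id-im : ∀ a b → 1# * b + 0# * a ≈ b
    id-im a b = trans (+-cong (*-identityˡ b) (zeroˡ a)) (+-identityʳ b)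
    dist-re : ∀ a b c d e f → a * (c + e) - b * (d + f) ≈ (a * c - b * d) + (a * e - b * f)
    dist-re = solve 6 (λ a b c d e f → a :* (c :+ e) :- b :* (d :+ f) := (a :* c :- b :* d) :+ (a :* e :- b :* f)) refl
    dist-im : ∀ a b c d e f → a * (d + f) + b * (c + e) ≈ (a * d + b * c) + (a * f + b * e)
    dist-im = solve 6 (λ a b c d e f → a :* (d :+ f) :+ b :* (c :+ e) := (a :* d :+ b :* c) :+ (a :* f :+ b :* e)) refl

    *ᶜ-comm : ∀ x y → (x *ᶜ y) ≈ᶜ (y *ᶜ x)
    *ᶜ-comm (a , b) (c , d) = comm-re a b c d , comm-im a b c d
    *ᶜ-identityˡ : ∀ x → ((1# , 0#) *ᶜ x) ≈ᶜ x
    *ᶜ-identityˡ (a , b) = id-re a b , id-im a b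
    *ᶜ-distribˡ : ∀ x y z → (x *ᶜ (y +ᶜ z)) ≈ᶜ ((x *ᶜ y) +ᶜ (x *ᶜ z))
    *ᶜ-distribˡ (a , b) (c , d) (e , f) = dist-re a b c d e f , dist-im a b c d e f
    ≈ᶜ-trans : ∀ {x y z} → x ≈ᶜ y → y ≈ᶜ z → x ≈ᶜ z
    ≈ᶜ-trans (p , q) (r , s) = trans p r , trans q s
    +ᶜ-cong : ∀ {x y u v} → x ≈ᶜ y → u ≈ᶜ v → (x +ᶜ u) ≈ᶜ (y +ᶜ v)
    +ᶜ-cong (p , q) (r , s) = +-cong p r , +-cong q s

  ℂ-ring : CRing
  ℂ-ring = record
    { Carrier = ℂ-Carrier
    ; _≈_ = _≈ᶜ_
    ; _+_ = _+ᶜ_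
    ; _*_ = _*ᶜ_
    ; -_ = λ (a , b) → - a , - b
    ; 0# = 0# , 0#
    ; 1# = 1# , 0#
    ; isCommutativeRing = record
      { isRing = record
        { +-isAbelianGroup = record
          { isGroup = record
            { isMonoid = record
              { isSemigroup = record
                { isMagma = record
                  { isEquivalence = record
                    { refl = refl , refl ; sym = λ (p , q) → sym p , sym q ; trans = ≈ᶜ-trans }
                  ; ∙-cong = +ᶜ-cong }
                ; assoc = λ x y z → +-assoc _ _ _ , +-assoc _ _ _ }
              ; identity = (λ x → +-identityˡ _ , +-identityˡ _) , (λ x → +-identityʳ _ , +-identityʳ _) }
            ; inverse = (λ x → -‿inverseˡ _ , -‿inverseˡ _) , (λ x → -‿inverseʳ _ , -‿inverseʳ _)
            ; ⁻¹-cong = λ (p , q) → -‿cong p , -‿cong q }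
          ; comm = λ x y → +-comm _ _ , +-comm _ _ }
        ; *-cong = λ (p , q) (r , s) →
            +-cong (*-cong p r) (-‿cong (*-cong q s)) , +-cong (*-cong p s) (*-cong q r)
        ; *-assoc = λ (a , b) (c , d) (e , f) → assoc-re a b c d e f , assoc-im a b c d e f
        ; *-identity = *ᶜ-identityˡ , λ x → ≈ᶜ-trans (*ᶜ-comm x (1# , 0#)) (*ᶜ-identityˡ x)
        ; distrib = *ᶜ-distribˡ , λ x y z → ≈ᶜ-trans (*ᶜ-comm (y +ᶜ z) x)
            (≈ᶜ-trans (*ᶜ-distribˡ x y z) (+ᶜ-cong (*ᶜ-comm x y) (*ᶜ-comm x z))) }
      ; *-comm = *ᶜ-comm } }

-- ℝ is axiomatised as a Dedekind-complete ordered field, hence unique up to isomorphism.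
record CompleteOrderedField : Set₁ where
  field
    field′ : Field
  open CommutativeRing (fieldRing field′) public
  infix 4 _≤_
  field
    _≤_          : Carrier → Carrier → Set
    isTotalOrder : IsTotalOrder _≈_ _≤_
    +-monoˡ-≤    : ∀ z {x y} → x ≤ y → x + z ≤ y + z
    *-nonNeg     : ∀ {x y} → 0# ≤ x → 0# ≤ y → 0# ≤ x * y
    complete     : (S : Pred Carrier 0ℓ) → ∃ S → (∃ λ u → ∀ x → S x → x ≤ u) →
                   ∃ λ u → (∀ x → S x → x ≤ u) × (∀ v → (∀ x → S x → x ≤ v) → u ≤ v)
  open ToStrict _≈_ _≤_ public using (_<_)
  ring′ : CRing
  ring′ = fieldRing field′
  open IntegerCast ring′ public using (fromℤ; fromℤ-hom)
  ℂ : CRing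
  ℂ = ComplexNumbers.ℂ-ring ring′

FiniteOverℚ : (E : CRing) → RingHom ℚₚ.+-*-commutativeRing E → Set
FiniteOverℚ E fromℚ = Σ ℕ λ n → Σ (Vector Carrier n) λ e → ∀ x → Σ (Vector ℚ n) λ c →
  x ≈ sum (λ j → RingHomomorphism.⟦_⟧ fromℚ (c j) * e j)
  where
  open CommutativeRing E
  open import Algebra.Properties.Monoid.Sum +-monoid using (sum)

-- The inclusion E ⊂ ℂ is the injective homomorphism embed; fromℚ is unique if it exists.
record NumberField (ℂ : CRing) : Set₁ where
  field
    E : Field
  E-ring : CRing
  E-ring = fieldRing E
  field
    embed    : RingHom E-ring ℂ
    fromℚ    : RingHom ℚₚ.+-*-commutativeRing E-ring
    ℚ-finite : FiniteOverℚ E-ring fromℚ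

-- Excluded middle is always an explicit hypothesis em, never assumed globally.
module Classical (em : ExcludedMiddle 0ℓ) where

  -- The inverse of x if there is one, and 0 otherwise.
  recip : (R : CRing) → CommutativeRing.Carrier R → CommutativeRing.Carrier R
  recip R x with em {∃ λ y → CommutativeRing._≈_ R (CommutativeRing._*_ R x y) (CommutativeRing.1# R)}
  ... | yes (y , _) = y
  ... | no _        = CommutativeRing.0# R

  select : ∀ {n} → Pred (Fin n) 0ℓ → List (Fin n)
  select {n} P = filter (λ j → em {P j}) (allFin n)

module _ (em : ExcludedMiddle 0ℓ) (ℝ : CompleteOrderedField) where
  open CompleteOrderedField ℝ
  open Classical em
  open import Algebra.Properties.Monoid.Sum +-monoid using (sum)
  open import Algebra.Properties.Semiring.Exp semiring using (_^_)

  -- The partial sums of 4 - 4/3 + 4/5 - ...; π is the only real number they enclose.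
  leibniz : ℕ → Carrier
  leibniz n = sum {n} λ k → (- 1#) ^ toℕ k * (fromℤ (+ 4) * recip ring′ (fromℤ (+ (1 ℕ.+ 2 ℕ.* toℕ k))))

  record IsPi (π : Carrier) : Set where
    field
      positive : 0# < π
      lower    : ∀ n → leibniz (2 ℕ.* n) ≤ π
      upper    : ∀ n → π ≤ leibniz (1 ℕ.+ 2 ℕ.* n)

module Premotivic (ℂ : CRing) (K : NumberField ℂ) where
  open NumberField K
  module ℂ = CommutativeRing ℂ

  infix 9 _⊗ℂ
  _⊗ℂ : Mod E-ring → Mod ℂ
  V ⊗ℂ = BaseChange.tensorModule E-ring ℂ embed V

  record PremotivicStructure : Set₁ where
    field
      H-B    : Mod E-ring
      H-dR   : Mod E-ring
      finite-B  : FiniteDimensional H-B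
      finite-dR : FiniteDimensional H-dR

    module B  = Module H-B
    module dR = Module H-dR
    module Bℂ  = BaseChange E-ring ℂ embed H-B
    module dRℂ = BaseChange E-ring ℂ embed H-dR

    field
      F∞            : B.Carrierᴹ → B.Carrierᴹ
      F∞-linear     : LinearMap H-B H-B F∞
      F∞-involutive : ∀ x → F∞ (F∞ x) B.≈ᴹ x

      H             : ℤ → ℤ → Submodule (H-B ⊗ℂ)
      Hodge-decomp  : LinearAlgebra.IsDirectSum (H-B ⊗ℂ) {ℤ × ℤ} (λ (p , q) → H p q)
      F∞-exchanges  : ∀ p q {x} → x ∈ˢ H p q → (F∞ Bℂ.⊗id) x ∈ˢ H q p

      Fil            : ℤ → Submodule H-dR
      Fil-decreasing : ∀ {k l} → k ℤ.≤ l → ∀ {x} → x ∈ˢ Fil l → x ∈ˢ Fil k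

      comparison     : Bℂ.Tensor → dRℂ.Tensor
      comparison-iso : LinearIso (H-B ⊗ℂ) (H-dR ⊗ℂ) comparison

    -- ⊕_{p ≥ k} H^{p,q}, to be matched with Fil^k ⊗ ℂ by the comparison
    HodgeFil : ℤ → Pred Bℂ.Tensor 0ℓ
    HodgeFil k = LinearAlgebra.SumOver (H-B ⊗ℂ) {ℤ × ℤ} (λ (p , q) → H p q) (λ (p , q) → k ℤ.≤ p)

    field
      Fil→Hodge : ∀ k {x} → comparison x ∈ (Fil k dRℂ.⊗ˢ) → x ∈ HodgeFil k
      Hodge→Fil : ∀ k {x} → x ∈ HodgeFil k → comparison x ∈ (Fil k dRℂ.⊗ˢ)

    h[_,_]≡_ : ℤ → ℤ → ℕ → Set
    h[ p , q ]≡ n = HasDimension (subModule (H-B ⊗ℂ) (H p q)) n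

    HasHodgeType : List (ℤ × ℤ) → Set
    HasHodgeType L = ∀ p q → h[ p , q ]≡ length (filter (λ pq → ≡-dec ℤₚ._≟_ ℤₚ._≟_ pq (p , q)) L)

    IsCritical : Set
    IsCritical = ∃ λ d → HasDimension (subModule H-B (fixedSpace H-B F∞ F∞-linear)) d
                       × HasDimension (quotient H-dR (Fil 0ℤ)) d

  -- Tensoring with ℚ(1), whose Betti and de Rham realisations are identified with ℚ via the
  -- basis 2πi, resp. 1: here F∞ acts by -1, the type is (-1,-1) and the comparison is 2πi.
  -- The argument u is 2πi.
  module _ (u : ℂ.Carrier) (u⁻¹ : ℂ.Carrier) (inv : u ℂ.* u⁻¹ ℂ.≈ ℂ.1#) where

    TateTwist : PremotivicStructure → PremotivicStructure
    TateTwist M = record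
      { H-B = H-B
      ; H-dR = H-dR
      ; finite-B = finite-B
      ; finite-dR = finite-dR
      ; F∞ = λ x → B.-ᴹ F∞ x
      ; F∞-linear = negate-linear H-B H-B F∞-linear
      ; F∞-involutive = λ x → B.≈ᴹ-trans (B.-ᴹ‿cong (-ᴹ-homo (F∞ x)))
          (B.≈ᴹ-trans (⁻¹-involutive _) (F∞-involutive x))
      ; H = λ p q → H (ℤ.suc p) (ℤ.suc q)
      ; Hodge-decomp = record
        { spans = λ x → shift⁻ U U (λ _ → tt) (Hodge-decomp .spans x)
        ; independent = λ i i-inj v v∈ → Hodge-decomp .independent
            (λ k → shift (i k)) (λ eq → i-inj (shift-injective eq)) v v∈ }
      ; F∞-exchanges = λ p q {x} x∈ → resp (H (ℤ.suc q) (ℤ.suc p)) (Bℂ.symᵗ (Bℂ.⊗id-negate F∞ x))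
          (*ₗ-closed (H (ℤ.suc q) (ℤ.suc p)) (ℂ.- ℂ.1#) (F∞-exchanges (ℤ.suc p) (ℤ.suc q) x∈))
      ; Fil = λ k → Fil (ℤ.suc k)
      ; Fil-decreasing = λ p → Fil-decreasing (ℤₚ.suc-mono p)
      ; comparison = λ x → u dRℂ.• comparison x
      ; comparison-iso = scale-iso (H-B ⊗ℂ) (H-dR ⊗ℂ) u u⁻¹ inv comparison-iso
      ; Fil→Hodge = λ k {x} x∈ → shift⁻ (ℤ.suc k ℤ.≤_) (k ℤ.≤_) unsuc-≤
          (Fil→Hodge (ℤ.suc k) (dRℂ.⊗ˢ-resp (Fil (ℤ.suc k)) (undo (comparison x)) (dRℂ.⊗ˢ-scale (Fil (ℤ.suc k)) u⁻¹ x∈)))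
      ; Hodge→Fil = λ k {x} x∈ → dRℂ.⊗ˢ-scale (Fil (ℤ.suc k)) u
          (Hodge→Fil (ℤ.suc k) (shift⁺ (k ℤ.≤_) (ℤ.suc k ℤ.≤_) ℤₚ.suc-mono x∈))
      }
      where
      open PremotivicStructure M
      open LinearAlgebra.IsDirectSum
      open LinearAlgebra.Submodule
      open IsModuleHomomorphism F∞-linear using (-ᴹ-homo)
      open import Algebra.Properties.AbelianGroup B.+ᴹ-abelianGroup using (⁻¹-involutive)
      module T = Module (H-dR ⊗ℂ)

      undo : ∀ w → u⁻¹ T.*ₗ (u T.*ₗ w) T.≈ᴹ w
      undo w = T.≈ᴹ-trans (T.≈ᴹ-sym (T.*ₗ-assoc _ _ _))
        (T.≈ᴹ-trans (T.*ₗ-congʳ (ℂ.trans (ℂ.*-comm _ _) inv)) (T.*ₗ-identityˡ w))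

      shift unshift : ℤ × ℤ → ℤ × ℤ
      shift (p , q) = ℤ.suc p , ℤ.suc q
      unshift (p , q) = ℤ.pred p , ℤ.pred q

      shift-injective : ∀ {x y} → shift x ≡ shift y → x ≡ y
      shift-injective {p , q} {p′ , q′} eq = ≡.cong₂ _,_
        (≡.trans (≡.sym (ℤₚ.pred-suc p)) (≡.trans (≡.cong (ℤ.pred ∘ proj₁) eq) (ℤₚ.pred-suc p′)))
        (≡.trans (≡.sym (ℤₚ.pred-suc q)) (≡.trans (≡.cong (ℤ.pred ∘ proj₂) eq) (ℤₚ.pred-suc q′)))

      unsuc-≤ : ∀ {k p} → ℤ.suc k ℤ.≤ p → k ℤ.≤ ℤ.pred p
      unsuc-≤ {k} {p} le = ≡.subst (ℤ._≤ ℤ.pred p) (ℤₚ.pred-suc k) (ℤₚ.pred-mono le)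

      H² H²′ : ℤ × ℤ → Submodule (H-B ⊗ℂ)
      H² (p , q) = H p q
      H²′ x = H² (shift x)

      shift⁺ : (J J′ : Pred ℤ 0ℓ) → (∀ {p} → J p → J′ (ℤ.suc p)) → ∀ {x} →
        LinearAlgebra.SumOver (H-B ⊗ℂ) H²′ (J ∘ proj₁) x → LinearAlgebra.SumOver (H-B ⊗ℂ) H² (J′ ∘ proj₁) x
      shift⁺ J J′ f (n , i , v , i∈ , v∈ , p) = n , shift ∘ i , v , (λ k → f (i∈ k)) , v∈ , p

      shift⁻ : (J J′ : Pred ℤ 0ℓ) → (∀ {p} → J p → J′ (ℤ.pred p)) → ∀ {x} →
        LinearAlgebra.SumOver (H-B ⊗ℂ) H² (J ∘ proj₁) x → LinearAlgebra.SumOver (H-B ⊗ℂ) H²′ (J′ ∘ proj₁) x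
      shift⁻ J J′ f (n , i , v , i∈ , v∈ , p) = n , unshift ∘ i , v , (λ k → f (i∈ k)) ,
        (λ k → ≡.subst (λ j → v k ∈ˢ H² j)
          (≡.sym (≡.cong₂ _,_ (ℤₚ.suc-pred (proj₁ (i k))) (ℤₚ.suc-pred (proj₂ (i k))))) (v∈ k)) , p

module _ (em : ExcludedMiddle 0ℓ) (ℝ : CompleteOrderedField) where
  open CompleteOrderedField ℝ
  private
    module F = HeytingField field′
    module ≤ = IsTotalOrder isTotalOrder
  open Classical em

  private
    recip-inverse : ∀ {x} → ¬ (x ≈ 0#) → x * recip ring′ x ≈ 1#
    recip-inverse {x} x≉0 with em {∃ λ y → x * y ≈ 1#}
    ... | yes (y , xy≈1) = xy≈1
    ... | no none with em {x F.# 0#}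
    ...   | no ¬x#0 = ⊥-elim (x≉0 (proj₁ (F.tight x 0#) ¬x#0))
    ...   | yes x#0 with F.#⇒invertible x#0
    ...     | y , _ , xy≈1 = ⊥-elim (none (y , trans (*-congʳ (sym x-0≈x)) xy≈1))
      where
      open import Algebra.Properties.Ring ring using (-0#≈0#)
      x-0≈x : x - 0# ≈ x
      x-0≈x = trans (+-congˡ -0#≈0#) (+-identityʳ x)

    2π≉0 : ∀ {π} → 0# < π → ¬ (π + π ≈ 0#)
    2π≉0 {π} (0≤π , 0≉π) 2π≈0 = 0≉π (≤.antisym 0≤π
      (≤.trans (≤.reflexive (sym (+-identityˡ π))) (≤.trans (+-monoˡ-≤ π 0≤π) (≤.reflexive 2π≈0))))

    2πi-inverse : ∀ r t → r * t ≈ 1# →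
      CommutativeRing._≈_ ℂ (CommutativeRing._*_ ℂ (0# , r) (0# , - t)) (CommutativeRing.1# ℂ)
    2πi-inverse r t rt≈1 =
      trans (trans (+-congʳ (zeroˡ 0#)) (trans (+-identityˡ _) (trans (-‿cong (sym (-‿distribʳ-* r t))) (-‿involutive _)))) rt≈1 ,
      trans (+-cong (zeroˡ _) (zeroʳ _)) (+-identityˡ 0#)
      where open import Algebra.Properties.Ring ring using (-‿distribʳ-*; -‿involutive)

  twist₁ : (K : NumberField ℂ) (π : Carrier) → IsPi em ℝ π →
           Premotivic.PremotivicStructure ℂ K → Premotivic.PremotivicStructure ℂ K
  twist₁ K π π-isPi = Premotivic.TateTwist ℂ K (0# , π + π) (0# , - recip ring′ (π + π))
    (2πi-inverse _ _ (recip-inverse (2π≉0 (IsPi.positive π-isPi))))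

-- The root datum (X^*(T), Φ, X_*(T), Φ^∨) of a split reductive group with split maximal torus T.
-- Roots and coroots are enumerated without repetition by Fin N, matching γ with γ^∨.
record RootDatum : Set₁ where
  field
    X Y : Mod ℤₚ.+-*-commutativeRing
  module X = Module X
  module Y = Module Y
  infix 8 ⟨_,_⟩
  field
    ⟨_,_⟩    : X.Carrierᴹ → Y.Carrierᴹ → ℤ
    ⟨⟩-cong  : ∀ {x x′ y y′} → x X.≈ᴹ x′ → y Y.≈ᴹ y′ → ⟨ x , y ⟩ ≡ ⟨ x′ , y′ ⟩
    ⟨⟩-+ˡ    : ∀ x x′ y → ⟨ x X.+ᴹ x′ , y ⟩ ≡ ⟨ x , y ⟩ ℤ.+ ⟨ x′ , y ⟩
    ⟨⟩-*ˡ    : ∀ a x y → ⟨ a X.*ₗ x , y ⟩ ≡ a ℤ.* ⟨ x , y ⟩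
    ⟨⟩-+ʳ    : ∀ x y y′ → ⟨ x , y Y.+ᴹ y′ ⟩ ≡ ⟨ x , y ⟩ ℤ.+ ⟨ x , y′ ⟩
    ⟨⟩-*ʳ    : ∀ a x y → ⟨ x , a Y.*ₗ y ⟩ ≡ a ℤ.* ⟨ x , y ⟩

    -- X and Y are free of finite rank and in perfect duality: there are dual bases.
    dim      : ℕ
    e        : Vector X.Carrierᴹ dim
    f        : Vector Y.Carrierᴹ dim
    e-basis  : LinearAlgebra.IsBasis X e
    f-basis  : LinearAlgebra.IsBasis Y f
    dual-≡   : ∀ j → ⟨ e j , f j ⟩ ≡ + 1
    dual-≢   : ∀ j k → j ≢ k → ⟨ e j , f k ⟩ ≡ 0ℤ

    N          : ℕ
    root       : Fin N → X.Carrierᴹ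
    coroot     : Fin N → Y.Carrierᴹ
    root-inj   : Injective _≡_ X._≈ᴹ_ root
    coroot-inj : Injective _≡_ Y._≈ᴹ_ coroot
    ⟨γ,γ^∨⟩≡2  : ∀ γ → ⟨ root γ , coroot γ ⟩ ≡ + 2
    reflect    : ∀ γ δ → ∃ λ ε → root ε X.≈ᴹ root δ X.+ᴹ X.-ᴹ (⟨ root δ , coroot γ ⟩ X.*ₗ root γ)
    coreflect  : ∀ γ δ → ∃ λ ε → coroot ε Y.≈ᴹ coroot δ Y.+ᴹ Y.-ᴹ (⟨ root γ , coroot δ ⟩ Y.*ₗ coroot γ)
    reduced    : ∀ γ δ → ¬ (root δ X.≈ᴹ (+ 2) X.*ₗ root γ)

-- A root datum with a choice of simple roots Δ_G, indexed by Fin rank.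
record BasedRootDatum : Set₁ where
  field
    rootDatum : RootDatum
  open RootDatum rootDatum public
  field
    rank   : ℕ
    simple : Fin rank → Fin N

  combine : Vector ℤ rank → X.Carrierᴹ
  combine c = LinearAlgebra.combination X c (root ∘ simple)

  NonNegative : Pred X.Carrierᴹ 0ℓ
  NonNegative x = Σ (Vector ℤ rank) λ c → (∀ j → 0ℤ ℤ.≤ c j) × x X.≈ᴹ combine c

  field
    simple-independent : LinearAlgebra.LinearlyIndependent X (root ∘ simple)
    simple-base        : ∀ γ → NonNegative (root γ) ⊎ NonNegative (X.-ᴹ root γ)

  Positive : Pred (Fin N) 0ℓ
  Positive γ = NonNegative (root γ)

-- The maximal parabolic P = MN of G with Δ_M = Δ_G \ {α}.
module MaximalParabolic (em : ExcludedMiddle 0ℓ) (ℝ : CompleteOrderedField)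
                        (G : BasedRootDatum) (α : Fin (BasedRootDatum.rank G)) where
  open CompleteOrderedField ℝ
  open BasedRootDatum G
  open Classical em
  open BaseChange ℤₚ.+-*-commutativeRing ring′ fromℤ-hom X public
    using (tensorModule; _⊗_) renaming (Tensor to X⊗ℝ)
  open BaseChange ℤₚ.+-*-commutativeRing ring′ fromℤ-hom X using (extend; extend-cong)
  open Module tensorModule public using (_+ᴹ_; _*ₗ_; -ᴹ_; _≈ᴹ_; 0ᴹ)

  ⟪_,_⟫ : X⊗ℝ → Y.Carrierᴹ → Carrier
  ⟪ μ , y ⟫ = extend (λ x → ⟨ x , y ⟩) μ

  ⟪⟫-cong : ∀ {μ ν} y → μ ≈ᴹ ν → ⟪ μ , y ⟫ ≈ ⟪ ν , y ⟫
  ⟪⟫-cong y = extend-cong (λ x → ⟨ x , y ⟩) (λ p → ⟨⟩-cong p Y.≈ᴹ-refl)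
    (λ x x′ → ⟨⟩-+ˡ x x′ y) (λ a x → ⟨⟩-*ˡ a x y)

  InM : Pred (Fin N) 0ℓ
  InM γ = Σ (Vector ℤ rank) λ c → c α ≡ 0ℤ × root γ X.≈ᴹ combine c

  -- The roots in Lie N are the positive roots that are not roots of M.
  InN : Pred (Fin N) 0ℓ
  InN γ = Positive γ × ¬ InM γ

  ρ-P : X⊗ℝ
  ρ-P = recip ring′ (fromℤ (+ 2)) *ₗ foldr _+ᴹ_ 0ᴹ (map (λ γ → root γ ⊗ 1#) (select InN))

  -- ⟨ρ_P, α^∨⟩ is positive, so recip is a genuine inverse here.
  α̃ : X⊗ℝ
  α̃ = recip ring′ ⟪ ρ-P , coroot (simple α) ⟫ *ₗ ρ-P

  InN^ : ℕ → Pred (Fin N) 0ℓ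
  InN^ i γ = InN γ × ⟪ α̃ , coroot γ ⟫ ≈ fromℤ (+ i)

  IsLargestDegree : ℕ → Set
  IsLargestDegree m = 1 ℕ.≤ m × ∃ (InN^ m) × (∀ j → 1 ℕ.≤ j → ∃ (InN^ j) → j ℕ.≤ m)

  AlgebraicallyIntegral : Pred X⊗ℝ 0ℓ
  AlgebraicallyIntegral μ = ∀ γ → ∃ λ k → ⟪ μ , coroot γ ⟫ ≈ fromℤ k

  data W-M-Orbit (μ : X⊗ℝ) : X⊗ℝ → Set where
    here  : ∀ {ν} → ν ≈ᴹ μ → W-M-Orbit μ ν
    there : ∀ {ν ν′} j → j ≢ α → W-M-Orbit μ ν →
            ν′ ≈ᴹ ν +ᴹ -ᴹ (⟪ ν , coroot (simple j) ⟫ *ₗ (root (simple j) ⊗ 1#)) → W-M-Orbit μ ν′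

  -- What the conditions on Π say about the infinitesimal character λ ∈ X^*(T) ⊗ ℝ of Π_∞:
  -- λ is the M-dominant representative of its orbit; Π is trivial on A = Z(M)^0, whose
  -- cocharacters are those orthogonal to Δ_M; and Π is unitary, so that its contragredient,
  -- with infinitesimal character -λ, is its complex conjugate, with infinitesimal character λ.
  record IsInfinitesimalCharacter (μ : X⊗ℝ) : Set where
    field
      dominant     : ∀ j → j ≢ α → 0# ≤ ⟪ μ , coroot (simple j) ⟫
      trivial-on-A : ∀ y → (∀ j → j ≢ α → ⟨ root (simple j) , y ⟩ ≡ 0ℤ) → ⟪ μ , y ⟫ ≈ 0#
      unitary      : W-M-Orbit μ (-ᴹ μ)

  -- b_i ∈ ℝ ∪ {∞}
  IsLeastPositive : X⊗ℝ → ℕ → Carrier ⁺ → Set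
  IsLeastPositive μ i [ b ] =
    (∃ λ γ → InN^ i γ × ⟪ μ , coroot γ ⟫ ≈ b) × 0# < b ×
    (∀ γ → InN^ i γ → 0# < ⟪ μ , coroot γ ⟫ → b ≤ ⟪ μ , coroot γ ⟫)
  IsLeastPositive μ i ⊤⁺ = ∀ γ → InN^ i γ → ¬ (0# < ⟪ μ , coroot γ ⟫)

  _≤[_-1]/_ : Carrier → Carrier ⁺ → ℕ → Set
  s ≤[ [ b ] -1]/ i = s ≤ (b - 1#) * recip ring′ (fromℤ (+ i))
  s ≤[ ⊤⁺ -1]/ i    = ⊤

  -- The Hodge type with multiplicities of M(r_i, Π ⊗ |s α̃|), listed by γ ∈ Φ_N^i.
  IsHodgeTypeList : X⊗ℝ → ℕ → Carrier → List (ℤ × ℤ) → Set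
  IsHodgeTypeList μ i s L = Pointwise
    (λ (p , q) γ → fromℤ p ≈ - ⟪ μ , coroot γ ⟫ - fromℤ (+ i) * s
                 × fromℤ q ≈ ⟪ μ , coroot γ ⟫ - fromℤ (+ i) * s)
    L (select (InN^ i))

{-# OPTIONS --safe #-}

-- Let V⁺ be the +1-eigenspace of F_∞ on H_B(1). The bound 0 < s ≤ (b_i - 1)/i forces every Hodge
-- type (p,q) of the twist with p ≠ q to satisfy p < 0 ≤ q or q < 0 ≤ p, and a type (p,p) to have
-- p < 0. Since F_∞ exchanges the first two kinds and is the identity on H^{p,p}, the space
-- V⁺ ⊗ ℂ is a complement of Fil⁰ = ⊕_{p ≥ 0} H^{p,q}. Hence V⁺ ⊗ ℂ → (H_dR / Fil⁰) ⊗ ℂ is bijective,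
-- and the two E-dimensions agree because its matrix in E-bases is square.

module Submission where

open import Defs
open import Algebra.Apartness.Bundles using (HeytingField)
open import Algebra.Bundles using (CommutativeMonoid; CommutativeRing)
open import Algebra.Module.Bundles using (Module)
open import Algebra.Module.Construct.TensorUnit using () renaming (⟨module⟩ to scalars)
open import Algebra.Module.Morphism.Structures using (IsModuleHomomorphism; IsModuleIsomorphism)
open import Algebra.Morphism.Bundles using (RingHomomorphism)
open import Axiom.ExcludedMiddle using (ExcludedMiddle)
open import Data.Empty using (⊥-elim)
open import Data.Fin.Base using (Fin; zero; suc; punchIn; punchOut; splitAt)
open import Data.Fin.Properties using (any?; punchIn-punchOut; splitAt⁻¹-↑ˡ; splitAt⁻¹-↑ʳ) renaming (_≟_ to _≟ᶠ_)
open import Data.Integer.Base as ℤ using (ℤ; +_; 0ℤ; 1ℤ)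
import Data.Integer.Properties as ℤₚ
open import Data.List.Base using (List; []; _∷_; allFin; filter; length)
open import Data.List.Relation.Binary.Pointwise.Base using (Pointwise; []; _∷_)
open import Data.List.Relation.Unary.All using (All; []; _∷_)
open import Data.List.Relation.Unary.All.Properties using (all-filter)
open import Data.Nat.Base as ℕ using (ℕ; zero; suc; s≤s)
import Data.Nat.Properties as ℕₚ
open import Data.Product using (Σ; ∃; ∃-syntax; _×_; _,_; proj₁; proj₂; swap)
open import Data.Product.Properties using (≡-dec)
open import Data.Rational.Base using () renaming (½ to ½ℚ)
open import Data.Sum.Base as Sum using (_⊎_; inj₁; inj₂)
open import Data.Vec.Functional as Vec using (Vector; removeAt; _++_; updateAt)
open import Function.Base using (_∘_; id)
open import Function.Definitions using (Injective)
open import Level using (Level; 0ℓ)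
open import Relation.Binary.Definitions using (DecidableEquality; Tri; tri<; tri≈; tri>)
open import Relation.Binary.PropositionalEquality as ≡ using (_≡_; _≢_)
open import Relation.Binary.Structures using (IsTotalOrder)
open import Relation.Nullary using (¬_; yes; no)
open import Relation.Nullary.Construct.Add.Supremum using (_⁺; ⊤⁺; [_])
open import Relation.Unary using (Decidable; Pred; _∈_)
import Algebra.Properties.Semiring.Exp as Exp
import Relation.Binary.Reasoning.Setoid as SetoidReasoning

-- The number `b` bounds the positive pairings from below, which are those of the types with p < q;
-- for p > q the mirror type is examined and F_∞ carries the conclusion over. A positive pairing x
-- satisfies is ≤ x - 1, and that unit is exactly what the Tate twist takes from q = x - is. The
-- complement is produced vector by vector, writing x in H^{p,q} with p < 0 ≤ q as (x + F_∞ x) - F_∞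
-- x, so no sum of Hodge numbers occurs. The other difficulty is the passage between E and ℂ.
-- Tensors are formal sums modulo relations, and neither V⁺ ⊗ ℂ nor (H_dR / Fil⁰) ⊗ ℂ is formed as a
-- module. Coordinates on the two E-spaces are pulled back to H_B and H_dR and extended to ℂ-valued
-- functionals. The role of V⁺ ⊗ ℂ is taken by the fixed vectors of F_∞ ⊗ id, which are spanned by
-- V⁺ because the projector (1 + F_∞)/2 is already defined over E.

open LinearAlgebra using (Submodule; subModule; quotient; HasDimension; FiniteDimensional)

-- The field axiom in a form that also applies to ℂ-ring, which carries no apartness relation.
ZeroOrUnit : CRing → Set
ZeroOrUnit R = ∀ x → x ≈ 0# ⊎ ∃ λ y → x * y ≈ 1#
  where open CommutativeRing R

HasHalf : CRing → Set
HasHalf R = ∃ λ h → h + h ≈ 1#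
  where open CommutativeRing R

NonZeroRing : CRing → Set
NonZeroRing R = ¬ (1# ≈ 0#)
  where open CommutativeRing R

-- Linear algebra over a field

module Combinations {R : CRing} (V : Mod R) where
  open CommutativeRing R hiding (zero)
  open Module V
  open LinearAlgebra V using (∑; combination)
  open import Algebra.Properties.CommutativeMonoid.Sum +ᴹ-commutativeMonoid public
    using (∑-distrib-+; sum-remove; sum-cong-≋; sum-replicate-zero)
  open import Algebra.Properties.CommutativeSemigroup
    (CommutativeMonoid.commutativeSemigroup +ᴹ-commutativeMonoid) public using () renaming (interchange to +ᴹ-interchange)
  open SetoidReasoning ≈ᴹ-setoid

  ∑-zero : ∀ {n} (v : Vector Carrierᴹ n) → (∀ j → v j ≈ᴹ 0ᴹ) → ∑ v ≈ᴹ 0ᴹ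
  ∑-zero {n} v v≈0 = ≈ᴹ-trans (sum-cong-≋ v≈0) (sum-replicate-zero n)

  ∑-single : ∀ {n} (v : Vector Carrierᴹ n) k → (∀ j → j ≢ k → v j ≈ᴹ 0ᴹ) → ∑ v ≈ᴹ v k
  ∑-single {suc n} v k v≈0 = begin
    ∑ v                        ≈⟨ sum-remove v ⟩
    v k +ᴹ ∑ (removeAt v k)    ≈⟨ +ᴹ-congˡ (∑-zero _ λ j → v≈0 (punchIn k j) (punchInᵢ≢i k j)) ⟩
    v k +ᴹ 0ᴹ                  ≈⟨ +ᴹ-identityʳ _ ⟩
    v k                        ∎
    where open import Data.Fin.Properties using (punchInᵢ≢i)

  ∑-++ : ∀ {m n} (u : Vector Carrierᴹ m) (v : Vector Carrierᴹ n) → ∑ (u ++ v) ≈ᴹ ∑ u +ᴹ ∑ v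
  ∑-++ {zero}  u v = ≈ᴹ-sym (+ᴹ-identityˡ _)
  ∑-++ {suc m} u v = begin
    u zero +ᴹ ∑ ((u ++ v) ∘ suc)      ≈⟨ +ᴹ-congˡ (sum-cong-≋ tail-++) ⟩
    u zero +ᴹ ∑ ((u ∘ suc) ++ v)      ≈⟨ +ᴹ-congˡ (∑-++ (u ∘ suc) v) ⟩
    u zero +ᴹ (∑ (u ∘ suc) +ᴹ ∑ v)    ≈⟨ +ᴹ-assoc _ _ _ ⟨
    ∑ u +ᴹ ∑ v                        ∎
    where
    open import Data.Fin.Base using (splitAt)
    tail-++ : ∀ j → (u ++ v) (suc j) ≈ᴹ ((u ∘ suc) ++ v) j
    tail-++ j with splitAt m j
    ... | inj₁ _ = ≈ᴹ-refl
    ... | inj₂ _ = ≈ᴹ-refl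

  combination-congʳ : ∀ {n} (c : Vector Carrier n) {v w : Vector Carrierᴹ n} →
    (∀ j → v j ≈ᴹ w j) → combination c v ≈ᴹ combination c w
  combination-congʳ c p = sum-cong-≋ (λ j → *ₗ-congˡ (p j))

  combination-zeroˡ : ∀ {n} (c : Vector Carrier n) (v : Vector Carrierᴹ n) →
    (∀ j → c j ≈ 0#) → combination c v ≈ᴹ 0ᴹ
  combination-zeroˡ c v p = ∑-zero _ λ j → ≈ᴹ-trans (*ₗ-congʳ (p j)) (*ₗ-zeroˡ _)

  combination-zeroʳ : ∀ {n} (c : Vector Carrier n) (v : Vector Carrierᴹ n) →
    (∀ j → v j ≈ᴹ 0ᴹ) → combination c v ≈ᴹ 0ᴹ
  combination-zeroʳ c v p = ∑-zero _ λ j → ≈ᴹ-trans (*ₗ-congˡ (p j)) (*ₗ-zeroʳ _)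

  *ₗ-∑ : ∀ {n} r (v : Vector Carrierᴹ n) → r *ₗ ∑ v ≈ᴹ ∑ (λ j → r *ₗ v j)
  *ₗ-∑ {zero}  r v = *ₗ-zeroʳ r
  *ₗ-∑ {suc n} r v = ≈ᴹ-trans (*ₗ-distribˡ r _ _) (+ᴹ-congˡ (*ₗ-∑ r (v ∘ suc)))

  combination-+ˡ : ∀ {n} (c d : Vector Carrier n) (v : Vector Carrierᴹ n) →
    combination (λ j → c j + d j) v ≈ᴹ combination c v +ᴹ combination d v
  combination-+ˡ c d v = ≈ᴹ-trans (sum-cong-≋ λ j → *ₗ-distribʳ (v j) (c j) (d j))
    (∑-distrib-+ (λ j → c j *ₗ v j) (λ j → d j *ₗ v j))

  combination-*ˡ : ∀ {n} r (c : Vector Carrier n) (v : Vector Carrierᴹ n) →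
    combination (λ j → r * c j) v ≈ᴹ r *ₗ combination c v
  combination-*ˡ r c v = ≈ᴹ-trans (sum-cong-≋ λ j → *ₗ-assoc r (c j) (v j))
    (≈ᴹ-sym (*ₗ-∑ r (λ j → c j *ₗ v j)))

  combination-+ʳ : ∀ {n} (c : Vector Carrier n) (v w : Vector Carrierᴹ n) →
    combination c (λ j → v j +ᴹ w j) ≈ᴹ combination c v +ᴹ combination c w
  combination-+ʳ c v w = ≈ᴹ-trans (sum-cong-≋ λ j → *ₗ-distribˡ (c j) (v j) (w j))
    (∑-distrib-+ (λ j → c j *ₗ v j) (λ j → c j *ₗ w j))

  combination-*ʳ : ∀ {n} r (c : Vector Carrier n) (v : Vector Carrierᴹ n) →
    combination c (λ j → r *ₗ v j) ≈ᴹ r *ₗ combination c v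
  combination-*ʳ r c v = ≈ᴹ-trans (sum-cong-≋ λ j → begin
      c j *ₗ (r *ₗ v j)    ≈⟨ *ₗ-assoc _ _ _ ⟨
      (c j * r) *ₗ v j     ≈⟨ *ₗ-congʳ (*-comm _ _) ⟩
      (r * c j) *ₗ v j     ≈⟨ *ₗ-assoc _ _ _ ⟩
      r *ₗ (c j *ₗ v j)    ∎)
    (≈ᴹ-sym (*ₗ-∑ r (λ j → c j *ₗ v j)))

  combination-remove : ∀ {n} (c : Vector Carrier (suc n)) (v : Vector Carrierᴹ (suc n)) k →
    combination c v ≈ᴹ c k *ₗ v k +ᴹ combination (removeAt c k) (removeAt v k)
  combination-remove c v k = sum-remove {i = k} (λ j → c j *ₗ v j)

module LinearMapSums {R : CRing} (V W : Mod R) {f : Module.Carrierᴹ V → Module.Carrierᴹ W} (f-linear : LinearMap V W f) where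
  private
    module V = Module V
    module W = Module W
    module LV = LinearAlgebra V
    module LW = LinearAlgebra W
  open IsModuleHomomorphism f-linear

  ∑-homo : ∀ {n} (v : Vector V.Carrierᴹ n) → f (LV.∑ v) W.≈ᴹ LW.∑ (f ∘ v)
  ∑-homo {zero}  v = 0ᴹ-homo
  ∑-homo {suc n} v = W.≈ᴹ-trans (+ᴹ-homo _ _) (W.+ᴹ-congˡ (∑-homo (v ∘ suc)))

  combination-homo : ∀ {n} c (v : Vector V.Carrierᴹ n) →
    f (LV.combination c v) W.≈ᴹ LW.combination c (f ∘ v)
  combination-homo c v = W.≈ᴹ-trans (∑-homo (λ j → c j V.*ₗ v j))
    (Combinations.sum-cong-≋ W (λ j → *ₗ-homo (c j) (v j)))

  surjective⇒spanning : (∀ y → ∃ λ x → f x W.≈ᴹ y) →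
    ∀ {n} {v : Vector V.Carrierᴹ n} → LV.Spanning v → LW.Spanning (f ∘ v)
  surjective⇒spanning surj {v = v} v-spans y =
    let x , fx≈y = surj y
        c , x≈cv = v-spans x
    in c , W.≈ᴹ-trans (W.≈ᴹ-sym fx≈y) (W.≈ᴹ-trans (⟦⟧-cong x≈cv) (combination-homo c v))

module _ (R : CRing) (zeroOrUnit : ZeroOrUnit R) (nonZero : NonZeroRing R) where
  open CommutativeRing R hiding (zero)
  open LinearAlgebra (scalars {R = R}) using (combination)
  open Combinations (scalars {R = R})
  open import Algebra.Properties.Ring ring using (-‿distribˡ-*)
  open SetoidReasoning setoid

  private
    zeroColumn? : ∀ {m n} (A : Fin m → Vector Carrier (suc n)) →
      (∀ r → A r zero ≈ 0#) ⊎ ∃ λ r → ∃ λ y → A r zero * y ≈ 1#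
    zeroColumn? {zero}  A = inj₁ λ ()
    zeroColumn? {suc m} A with zeroOrUnit (A zero zero) | zeroColumn? (A ∘ suc)
    ... | inj₂ unit | _                 = inj₂ (zero , unit)
    ... | inj₁ _    | inj₂ (r , unit)   = inj₂ (suc r , unit)
    ... | inj₁ z    | inj₁ zs           = inj₁ λ { zero → z ; (suc r) → zs r }

  -- Gaussian elimination: the pivot is sought in the column of the first unknown.
  nontrivialSolution : ∀ {m n} → m ℕ.< n → (A : Fin m → Vector Carrier n) →
    Σ (Vector Carrier n) λ z → (∀ r → combination z (A r) ≈ 0#) × ∃ λ j → ¬ (z j ≈ 0#)
  nontrivialSolution {m} {suc n} m<n A with zeroColumn? A
  ... | inj₁ A₀≈0 = 1# Vec.∷ (λ _ → 0#) ,
        (λ r → begin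
          1# * A r zero + combination (λ _ → 0#) (A r ∘ suc)
            ≈⟨ +-cong (*-identityˡ _) (combination-zeroˡ (λ _ → 0#) (A r ∘ suc) λ _ → refl) ⟩
          A r zero + 0#    ≈⟨ +-identityʳ _ ⟩
          A r zero         ≈⟨ A₀≈0 r ⟩
          0#               ∎) ,
        zero , nonZero
  nontrivialSolution {suc m} {suc n} (s≤s m<n) A | inj₂ (r₀ , y , ay≈1) =
    let z , zB≈0 , j , zj≉0 = nontrivialSolution m<n B
    in z₀ z Vec.∷ z , solves z zB≈0 , suc j , zj≉0
    where
    a = A r₀ zero
    t : Fin (suc m) → Vector Carrier n
    t r = A r ∘ suc
    -- `y` inverts the pivot, so this multiple of the pivot row cancels the first coefficient of
    -- each other row; `z₀` is then the pivot equation solved for the first unknown.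
    B : Fin m → Vector Carrier n
    B r l = t (punchIn r₀ r) l + - (A (punchIn r₀ r) zero * y) * t r₀ l
    z₀ : Vector Carrier n → Carrier
    z₀ z = - (y * combination z (t r₀))
    solves : ∀ z → (∀ r → combination z (B r) ≈ 0#) → ∀ r → combination (z₀ z Vec.∷ z) (A r) ≈ 0#
    solves z zB≈0 r with r₀ ≟ᶠ r
    ... | yes ≡.refl = begin
      - (y * S) * a + S      ≈⟨ +-congʳ (-‿distribˡ-* _ _) ⟨
      - (y * S * a) + S      ≈⟨ +-congʳ (-‿cong ySa≈S) ⟩
      - S + S                ≈⟨ -‿inverseˡ S ⟩
      0#                     ∎
      where
      S = combination z (t r₀)
      ySa≈S : y * S * a ≈ S
      ySa≈S = begin
        y * S * a      ≈⟨ *-comm _ _ ⟩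
        a * (y * S)    ≈⟨ *-assoc _ _ _ ⟨
        a * y * S      ≈⟨ *-congʳ ay≈1 ⟩
        1# * S         ≈⟨ *-identityˡ S ⟩
        S              ∎
    ... | no r₀≢r = begin
      - (y * S) * c + T          ≈⟨ +-comm _ _ ⟩
      T + - (y * S) * c          ≈⟨ +-congˡ moved ⟩
      T + - (c * y) * S          ≈⟨ +-congˡ (combination-*ʳ (- (c * y)) z (t r₀)) ⟨
      T + combination z (λ l → - (c * y) * t r₀ l)
                                 ≈⟨ combination-+ʳ z (t r) (λ l → - (c * y) * t r₀ l) ⟨
      combination z (λ l → t r l + - (c * y) * t r₀ l)
                                 ≡⟨ ≡.cong (λ r → combination z (λ l → t r l + - (A r zero * y) * t r₀ l)) (punchIn-punchOut r₀≢r) ⟨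
      combination z (B (punchOut r₀≢r))
                                 ≈⟨ zB≈0 (punchOut r₀≢r) ⟩
      0#                         ∎
      where
      S = combination z (t r₀)
      T = combination z (t r)
      c = A r zero
      moved : - (y * S) * c ≈ - (c * y) * S
      moved = begin
        - (y * S) * c      ≈⟨ -‿distribˡ-* _ _ ⟨
        - (y * S * c)      ≈⟨ -‿cong (trans (*-comm _ _) (sym (*-assoc _ _ _))) ⟩
        - (c * y * S)      ≈⟨ -‿distribˡ-* _ _ ⟩
        - (c * y) * S      ∎

-- Bases extracted from spanning families

module _ (em : ExcludedMiddle 0ℓ) {R : CRing} (zeroOrUnit : ZeroOrUnit R) (V : Mod R) where
  open CommutativeRing R hiding (zero)
  open Module V
  open LinearAlgebra V using (∑; combination; LinearlyIndependent; Spanning)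
  open Combinations V
  open SetoidReasoning ≈ᴹ-setoid

  private
    -- A dependence is useful for discarding a vector only if that vector has an invertible
    -- coefficient. If no such dependence exists, the dichotomy "zero or unit" makes every
    -- coefficient of every dependence zero.
    independent? : ∀ {n} (v : Vector Carrierᴹ n) → LinearlyIndependent v ⊎
      Σ (Vector Carrier n) λ c → combination c v ≈ᴹ 0ᴹ × ∃ λ k → ∃ λ y → c k * y ≈ 1#
    independent? {n} v with em {Σ (Vector Carrier n) λ c → combination c v ≈ᴹ 0ᴹ × ∃ λ k → ∃ λ y → c k * y ≈ 1#}
    ... | yes dep = inj₂ dep
    ... | no ¬dep = inj₁ λ c cv≈0 k → excluded c cv≈0 k (zeroOrUnit (c k))
      where
      excluded : ∀ c → combination c v ≈ᴹ 0ᴹ → ∀ k → c k ≈ 0# ⊎ (∃ λ y → c k * y ≈ 1#) → c k ≈ 0#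
      excluded c cv≈0 k (inj₁ ck≈0) = ck≈0
      excluded c cv≈0 k (inj₂ unit) = ⊥-elim (¬dep (c , cv≈0 , k , unit))

    spanning-remove : ∀ {n} (v : Vector Carrierᴹ (suc n)) c → combination c v ≈ᴹ 0ᴹ →
      ∀ k y → c k * y ≈ 1# → Spanning v → Spanning (removeAt v k)
    spanning-remove v c cv≈0 k y cy≈1 v-spans x = let d , x≈dv = v-spans x in _ , go d x≈dv
      where
      v′ = removeAt v k
      c′ = removeAt c k
      vk : v k ≈ᴹ combination (λ l → - y * c′ l) v′
      vk = begin
        v k                                                          ≈⟨ *ₗ-identityˡ _ ⟨
        1# *ₗ v k                                                    ≈⟨ *ₗ-congʳ (trans (*-comm y _) cy≈1) ⟨
        (y * c k) *ₗ v k                                             ≈⟨ *ₗ-assoc _ _ _ ⟩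
        y *ₗ (c k *ₗ v k)                                            ≈⟨ *ₗ-congˡ (inverseˡ-unique _ _ rel) ⟩
        y *ₗ (-ᴹ combination c′ v′)                                  ≈⟨ inverseˡ-unique _ _ neg ⟩
        -ᴹ (y *ₗ combination c′ v′)                                  ≈⟨ inverseˡ-unique _ _ neg′ ⟨
        (- y) *ₗ combination c′ v′                                   ≈⟨ combination-*ˡ (- y) c′ v′ ⟨
        combination (λ l → - y * c′ l) v′                            ∎
        where
        open import Algebra.Properties.AbelianGroup +ᴹ-abelianGroup using (inverseˡ-unique)
        rel : c k *ₗ v k +ᴹ combination c′ v′ ≈ᴹ 0ᴹ
        rel = ≈ᴹ-trans (≈ᴹ-sym (combination-remove c v k)) cv≈0
        neg : y *ₗ (-ᴹ combination c′ v′) +ᴹ y *ₗ combination c′ v′ ≈ᴹ 0ᴹ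
        neg = ≈ᴹ-trans (≈ᴹ-sym (*ₗ-distribˡ y _ _)) (≈ᴹ-trans (*ₗ-congˡ (-ᴹ‿inverseˡ _)) (*ₗ-zeroʳ y))
        neg′ : (- y) *ₗ combination c′ v′ +ᴹ y *ₗ combination c′ v′ ≈ᴹ 0ᴹ
        neg′ = ≈ᴹ-trans (≈ᴹ-sym (*ₗ-distribʳ _ (- y) y)) (≈ᴹ-trans (*ₗ-congʳ (-‿inverseˡ y)) (*ₗ-zeroˡ _))
      go : ∀ d → x ≈ᴹ combination d v → x ≈ᴹ combination (λ l → d k * (- y * c′ l) + removeAt d k l) v′
      go d x≈dv = begin
        x                                                             ≈⟨ x≈dv ⟩
        combination d v                                               ≈⟨ combination-remove d v k ⟩
        d k *ₗ v k +ᴹ combination (removeAt d k) v′                   ≈⟨ +ᴹ-congʳ (*ₗ-congˡ vk) ⟩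
        d k *ₗ combination (λ l → - y * c′ l) v′ +ᴹ combination (removeAt d k) v′
          ≈⟨ +ᴹ-congʳ (combination-*ˡ (d k) (λ l → - y * c′ l) v′) ⟨
        combination (λ l → d k * (- y * c′ l)) v′ +ᴹ combination (removeAt d k) v′
          ≈⟨ combination-+ˡ (λ l → d k * (- y * c′ l)) (removeAt d k) v′ ⟨
        combination (λ l → d k * (- y * c′ l) + removeAt d k l) v′    ∎

  -- Redundant vectors are discarded one at a time, by recursion on the length of the family.
  -- Criticality asks for actual bases of an eigenspace and of a quotient, and both are obtained
  -- this way from images of bases of H_B and H_dR.
  spanning⇒finiteDimensional : ∀ {n} (v : Vector Carrierᴹ n) → Spanning v → FiniteDimensional V
  spanning⇒finiteDimensional {n} v v-spans with independent? v
  spanning⇒finiteDimensional {n} v v-spans | inj₁ v-indep = n , v , v-indep , v-spans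
  spanning⇒finiteDimensional {suc n} v v-spans | inj₂ (c , cv≈0 , k , y , cy≈1) =
    spanning⇒finiteDimensional (removeAt v k) (spanning-remove v c cv≈0 k y cy≈1 v-spans)

module Coordinates {R : CRing} (V : Mod R) {n : ℕ} (v : Vector (Module.Carrierᴹ V) n)
                   (v-basis : LinearAlgebra.IsBasis V v) where
  open CommutativeRing R hiding (zero)
  open Module V
  open LinearAlgebra V using (combination)
  open Combinations V
  open import Algebra.Properties.Ring ring using (x∙y⁻¹≈ε⇒x≈y; -1*x≈-x)
  open SetoidReasoning ≈ᴹ-setoid

  -- The spanning witness picks coefficients without any compatibility with equality or addition;
  -- uniqueness, from linear independence, is what makes these functions linear.
  coord : Fin n → Carrierᴹ → Carrier
  coord k x = proj₁ (proj₂ v-basis x) k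

  combination-coord : ∀ x → x ≈ᴹ combination (λ k → coord k x) v
  combination-coord x = proj₂ (proj₂ v-basis x)

  combination-injective : ∀ c d → combination c v ≈ᴹ combination d v → ∀ k → c k ≈ d k
  combination-injective c d cv≈dv k = x∙y⁻¹≈ε⇒x≈y _ _ (trans (+-congˡ (sym (-1*x≈-x _)))
    (proj₁ v-basis (λ j → c j + - 1# * d j) (begin
      combination (λ j → c j + - 1# * d j) v                   ≈⟨ combination-+ˡ c (λ j → - 1# * d j) v ⟩
      combination c v +ᴹ combination (λ j → - 1# * d j) v      ≈⟨ +ᴹ-cong cv≈dv (combination-*ˡ (- 1#) d v) ⟩
      combination d v +ᴹ (- 1#) *ₗ combination d v             ≈⟨ +ᴹ-congʳ (*ₗ-identityˡ _) ⟨
      1# *ₗ combination d v +ᴹ (- 1#) *ₗ combination d v       ≈⟨ *ₗ-distribʳ _ _ _ ⟨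
      (1# - 1#) *ₗ combination d v                             ≈⟨ *ₗ-congʳ (-‿inverseʳ 1#) ⟩
      0# *ₗ combination d v                                    ≈⟨ *ₗ-zeroˡ _ ⟩
      0ᴹ                                                       ∎) k))

  coord-unique : ∀ c x → x ≈ᴹ combination c v → ∀ k → coord k x ≈ c k
  coord-unique c x x≈cv = combination-injective (λ k → coord k x) c (≈ᴹ-trans (≈ᴹ-sym (combination-coord x)) x≈cv)

  coord-linear : ∀ k → LinearMap V scalars (coord k)
  coord-linear k = mkLinear V scalars (coord k)
    (λ {x} {y} x≈y → coord-unique _ x (≈ᴹ-trans x≈y (combination-coord y)) k)
    (λ x y → coord-unique _ _ (≈ᴹ-trans (+ᴹ-cong (combination-coord x) (combination-coord y))
      (≈ᴹ-sym (combination-+ˡ _ _ v))) k)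
    (λ r x → coord-unique _ _ (≈ᴹ-trans (*ₗ-congˡ (combination-coord x)) (≈ᴹ-sym (combination-*ˡ r _ v))) k)

  private
    δ : Fin n → Vector Carrier n
    δ j k with j ≟ᶠ k
    ... | yes _ = 1#
    ... | no  _ = 0#

    δ-≡ : ∀ j → δ j j ≈ 1#
    δ-≡ j with j ≟ᶠ j
    ... | yes _ = refl
    ... | no j≢j = ⊥-elim (j≢j ≡.refl)

    δ-≢ : ∀ {j k} → j ≢ k → δ j k ≈ 0#
    δ-≢ {j} {k} j≢k with j ≟ᶠ k
    ... | yes j≡k = ⊥-elim (j≢k j≡k)
    ... | no  _ = refl

    v≈δv : ∀ j → v j ≈ᴹ combination (δ j) v
    v≈δv j = ≈ᴹ-sym (begin
      combination (δ j) v    ≈⟨ ∑-single (λ k → δ j k *ₗ v k) j (λ k k≢j → ≈ᴹ-trans (*ₗ-congʳ (δ-≢ (k≢j ∘ ≡.sym))) (*ₗ-zeroˡ _)) ⟩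
      δ j j *ₗ v j           ≈⟨ *ₗ-congʳ (δ-≡ j) ⟩
      1# *ₗ v j              ≈⟨ *ₗ-identityˡ _ ⟩
      v j                    ∎)

  coord-basis-≡ : ∀ j → coord j (v j) ≈ 1#
  coord-basis-≡ j = trans (coord-unique (δ j) (v j) (v≈δv j) j) (δ-≡ j)

  coord-basis-≢ : ∀ {j k} → j ≢ k → coord k (v j) ≈ 0#
  coord-basis-≢ {j} {k} j≢k = trans (coord-unique (δ j) (v j) (v≈δv j) k) (δ-≢ j≢k)

module _ {R : CRing} (U V W : Mod R) {f : Module.Carrierᴹ V → Module.Carrierᴹ W} {g : Module.Carrierᴹ U → Module.Carrierᴹ V} where
  ∘-linear : LinearMap V W f → LinearMap U V g → LinearMap U W (f ∘ g)
  ∘-linear f-linear g-linear = mkLinear U W (f ∘ g)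
    (λ p → f.⟦⟧-cong (g.⟦⟧-cong p))
    (λ x y → W.≈ᴹ-trans (f.⟦⟧-cong (g.+ᴹ-homo x y)) (f.+ᴹ-homo _ _))
    (λ r x → W.≈ᴹ-trans (f.⟦⟧-cong (g.*ₗ-homo r x)) (f.*ₗ-homo r _))
    where
    module W = Module W
    module f = IsModuleHomomorphism f-linear
    module g = IsModuleHomomorphism g-linear

-- Direct sums indexed with repetition

module _ {a : Level} {A : Set a} where
  ++-all : ∀ {p} {P : A → Set p} {m n} (u : Vector A m) (v : Vector A n) →
    (∀ k → P (u k)) → (∀ k → P (v k)) → ∀ k → P ((u ++ v) k)
  ++-all {m = m} u v Pu Pv k with splitAt m k
  ... | inj₁ j = Pu j
  ... | inj₂ j = Pv j

  ++-all₂ : ∀ {b r} {B : Set b} {R : A → B → Set r} {m n} (u : Vector A m) (v : Vector A n) (s : Vector B m) (t : Vector B n) →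
    (∀ k → R (u k) (s k)) → (∀ k → R (v k) (t k)) → ∀ k → R ((u ++ v) k) ((s ++ t) k)
  ++-all₂ {m = m} u v s t Ru Rv k with splitAt m k
  ... | inj₁ j = Ru j
  ... | inj₂ j = Rv j

  injective-++ : ∀ {m n} (u : Vector A m) (v : Vector A n) → Injective _≡_ _≡_ u → Injective _≡_ _≡_ v →
    (∀ j k → u j ≢ v k) → Injective _≡_ _≡_ (u ++ v)
  injective-++ {m} {n} u v u-inj v-inj u≢v {j} {k} eq with splitAt m j in j-eq | splitAt m k in k-eq
  ... | inj₁ j′ | inj₁ k′ = ≡.trans (≡.sym (splitAt⁻¹-↑ˡ j-eq)) (≡.trans (≡.cong _ (u-inj eq)) (splitAt⁻¹-↑ˡ k-eq))
  ... | inj₁ j′ | inj₂ k′ = ⊥-elim (u≢v j′ k′ eq)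
  ... | inj₂ j′ | inj₁ k′ = ⊥-elim (u≢v k′ j′ (≡.sym eq))
  ... | inj₂ j′ | inj₂ k′ = ≡.trans (≡.sym (splitAt⁻¹-↑ʳ {i = j} j-eq)) (≡.trans (≡.cong _ (v-inj eq)) (splitAt⁻¹-↑ʳ {i = k} k-eq))

module DirectSums {R : CRing} (V : Mod R) {I : Set} (_≟_ : DecidableEquality I) (W : I → Submodule V) where
  open CommutativeRing R hiding (zero)
  open Module V
  open LinearAlgebra V using (SumOver; IsDirectSum; ∑)
  open Combinations V
  open Submodule
  open SetoidReasoning ≈ᴹ-setoid

  SumOver-single : ∀ {J : Pred I 0ℓ} {j x} → J j → x ∈ˢ W j → SumOver W J x
  SumOver-single {j = j} {x} j∈J x∈W = 1 , (λ _ → j) , (λ _ → x) , (λ _ → j∈J) , (λ _ → x∈W) , ≈ᴹ-sym (+ᴹ-identityʳ x)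

  SumOver-0 : ∀ {J : Pred I 0ℓ} → SumOver W J 0ᴹ
  SumOver-0 = 0 , (λ ()) , (λ ()) , (λ ()) , (λ ()) , ≈ᴹ-refl

  SumOver-+ : ∀ {J : Pred I 0ℓ} {x y} → SumOver W J x → SumOver W J y → SumOver W J (x +ᴹ y)
  SumOver-+ {J} (m , i , u , i∈ , u∈ , x≈u) (n , j , v , j∈ , v∈ , y≈v) =
    m ℕ.+ n , i ++ j , u ++ v , ++-all {P = J} i j i∈ j∈ , ++-all₂ {R = λ i u → u ∈ˢ W i} i j u v u∈ v∈ ,
    ≈ᴹ-trans (+ᴹ-cong x≈u y≈v) (≈ᴹ-sym (∑-++ u v))

  -- `SumOver` permits repeated indices, whereas independence in a direct sum speaks of distinct
  -- ones. This is the normal form to which independence can be applied.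
  record DistinctSumOver (J : Pred I 0ℓ) (x : Carrierᴹ) : Set where
    constructor distinctSum
    field
      {size}   : ℕ
      index    : Vector I size
      distinct : Injective _≡_ _≡_ index
      term     : Vector Carrierᴹ size
      index∈   : ∀ k → J (index k)
      term∈    : ∀ k → term k ∈ˢ W (index k)
      total    : x ≈ᴹ ∑ term

  private
    add : ∀ {J : Pred I 0ℓ} {j x y} → J j → y ∈ˢ W j → DistinctSumOver J x → DistinctSumOver J (y +ᴹ x)
    add {j = j} {x} {y} j∈J y∈W (distinctSum i i-inj v i∈ v∈ x≈v) with any? (λ k → i k ≟ j)
    ... | no new = distinctSum (j Vec.∷ i) cons-inj (y Vec.∷ v) (λ { zero → j∈J ; (suc k) → i∈ k })
          (λ { zero → y∈W ; (suc k) → v∈ k }) (+ᴹ-congˡ x≈v)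
      where
      cons-inj : Injective _≡_ _≡_ (j Vec.∷ i)
      cons-inj {zero}  {zero}  eq = ≡.refl
      cons-inj {zero}  {suc l} eq = ⊥-elim (new (l , ≡.sym eq))
      cons-inj {suc k} {zero}  eq = ⊥-elim (new (k , eq))
      cons-inj {suc k} {suc l} eq = ≡.cong suc (i-inj eq)
    ... | yes (k , ik≡j) = distinctSum i i-inj (updateAt v k (y +ᴹ_)) i∈ (updated∈ i v v∈ k (≡.subst (λ j → y ∈ˢ W j) (≡.sym ik≡j) y∈W))
          (≈ᴹ-trans (+ᴹ-congˡ x≈v) (≈ᴹ-sym (∑-update v k)))
      where
      updated∈ : ∀ {n} (i : Vector I n) (v : Vector Carrierᴹ n) → (∀ l → v l ∈ˢ W (i l)) → ∀ k → y ∈ˢ W (i k) →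
        ∀ l → updateAt v k (y +ᴹ_) l ∈ˢ W (i l)
      updated∈ i v v∈ zero    y∈ zero    = +-closed (W (i zero)) y∈ (v∈ zero)
      updated∈ i v v∈ zero    y∈ (suc l) = v∈ (suc l)
      updated∈ i v v∈ (suc k) y∈ zero    = v∈ zero
      updated∈ i v v∈ (suc k) y∈ (suc l) = updated∈ (i ∘ suc) (v ∘ suc) (v∈ ∘ suc) k y∈ l
      ∑-update : ∀ {n} (v : Vector Carrierᴹ n) k → ∑ (updateAt v k (y +ᴹ_)) ≈ᴹ y +ᴹ ∑ v
      ∑-update v zero    = +ᴹ-assoc _ _ _
      ∑-update v (suc k) = begin
        v zero +ᴹ ∑ (updateAt (v ∘ suc) k (y +ᴹ_))    ≈⟨ +ᴹ-congˡ (∑-update (v ∘ suc) k) ⟩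
        v zero +ᴹ (y +ᴹ ∑ (v ∘ suc))                  ≈⟨ +ᴹ-assoc _ _ _ ⟨
        (v zero +ᴹ y) +ᴹ ∑ (v ∘ suc)                  ≈⟨ +ᴹ-congʳ (+ᴹ-comm _ _) ⟩
        (y +ᴹ v zero) +ᴹ ∑ (v ∘ suc)                  ≈⟨ +ᴹ-assoc _ _ _ ⟩
        y +ᴹ ∑ v                                      ∎

    resp-≈ : ∀ {J : Pred I 0ℓ} {x y} → x ≈ᴹ y → DistinctSumOver J x → DistinctSumOver J y
    resp-≈ p (distinctSum i i-inj v i∈ v∈ q) = distinctSum i i-inj v i∈ v∈ (≈ᴹ-trans (≈ᴹ-sym p) q)

  -- Terms with equal index are merged, and terms in spaces known to be zero are dropped. The
  -- dropping is what allows the index condition to be sharpened: for Fil⁰, from 0 ≤ p to 0 ≤ p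
  -- together with q < 0.
  collect : ∀ {J J′ : Pred I 0ℓ} → (∀ j → J j → J′ j ⊎ (∀ {x} → x ∈ˢ W j → x ≈ᴹ 0ᴹ)) →
    ∀ {x} → SumOver W J x → DistinctSumOver J′ x
  collect {J} {J′} refine {x} (n , i , v , i∈ , v∈ , x≈v) = resp-≈ (≈ᴹ-sym x≈v) (go i v i∈ v∈)
    where
    go : ∀ {n} (i : Vector I n) (v : Vector Carrierᴹ n) → (∀ k → J (i k)) → (∀ k → v k ∈ˢ W (i k)) → DistinctSumOver J′ (∑ v)
    go {zero}  i v i∈ v∈ = distinctSum i (λ { {()} }) v (λ ()) (λ ()) ≈ᴹ-refl
    go {suc n} i v i∈ v∈ with refine (i zero) (i∈ zero)
    ... | inj₁ i₀∈J′ = add i₀∈J′ (v∈ zero) (go (i ∘ suc) (v ∘ suc) (i∈ ∘ suc) (v∈ ∘ suc))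
    ... | inj₂ Wi₀≈0 = resp-≈ (≈ᴹ-sym (≈ᴹ-trans (+ᴹ-congʳ (Wi₀≈0 (v∈ zero))) (+ᴹ-identityˡ _)))
          (go (i ∘ suc) (v ∘ suc) (i∈ ∘ suc) (v∈ ∘ suc))

  -- Subtracting the two expansions of x gives a relation over the concatenated indices, which are
  -- still distinct; independence then kills every term of the first expansion.
  disjoint⇒0 : IsDirectSum W → ∀ {J J′ : Pred I 0ℓ} → (∀ j → J j → ¬ J′ j) →
    ∀ {x} → DistinctSumOver J x → DistinctSumOver J′ x → x ≈ᴹ 0ᴹ
  disjoint⇒0 W-direct {J′ = J′} J∩J′ {x} (distinctSum i i-inj u i∈ u∈ x≈u) (distinctSum j j-inj v j∈ v∈ x≈v) =
    ≈ᴹ-trans x≈u (∑-zero u λ k → ≈ᴹ-trans (≈ᴹ-reflexive (≡.sym (lookup-++ˡ u -v k))) (vanish (k ↑ˡ _)))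
    where
    open import Data.Fin.Base using (_↑ˡ_)
    open import Data.Vec.Functional.Properties using (lookup-++ˡ)
    -v = λ k → (- 1#) *ₗ v k
    sum≈0 : ∑ (u ++ -v) ≈ᴹ 0ᴹ
    sum≈0 = begin
      ∑ (u ++ -v)                      ≈⟨ ∑-++ u -v ⟩
      ∑ u +ᴹ ∑ -v                      ≈⟨ +ᴹ-cong (≈ᴹ-sym x≈u) (≈ᴹ-trans (≈ᴹ-sym (*ₗ-∑ (- 1#) v)) (*ₗ-congˡ (≈ᴹ-sym x≈v))) ⟩
      x +ᴹ (- 1#) *ₗ x                 ≈⟨ +ᴹ-congʳ (*ₗ-identityˡ x) ⟨
      1# *ₗ x +ᴹ (- 1#) *ₗ x           ≈⟨ *ₗ-distribʳ x 1# (- 1#) ⟨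
      (1# - 1#) *ₗ x                   ≈⟨ *ₗ-congʳ (-‿inverseʳ 1#) ⟩
      0# *ₗ x                          ≈⟨ *ₗ-zeroˡ x ⟩
      0ᴹ                               ∎
    vanish = IsDirectSum.independent W-direct (i ++ j)
      (injective-++ i j i-inj j-inj (λ k l eq → J∩J′ (i k) (i∈ k) (≡.subst J′ (≡.sym eq) (j∈ l))))
      (u ++ -v) (++-all₂ {R = λ i u → u ∈ˢ W i} i j u -v u∈ (λ k → *ₗ-closed (W (j k)) (- 1#) (v∈ k))) sum≈0

-- Extension of scalars

module TensorMaps (R S : CRing) (φ : RingHom R S) (V : Mod R) where
  open BaseChange R S φ V
  private
    module R = CommutativeRing R
    module S = CommutativeRing S
    module V = Module V
    module T = Module tensorModule
    module φ = RingHomomorphism φ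
    module LV = LinearAlgebra V
    module LT = LinearAlgebra tensorModule
    module ST = Combinations tensorModule

  0⊗ : ∀ c → V.0ᴹ ⊗ c ≈⊗ 𝟎
  0⊗ c = transᵗ (⊗-cong (V.≈ᴹ-sym (V.*ₗ-zeroˡ V.0ᴹ)) S.refl) (transᵗ (⊗-balance R.0# V.0ᴹ c)
    (transᵗ (⊗-cong V.≈ᴹ-refl (S.trans (S.*-congʳ φ.0#-homo) (S.zeroˡ c))) (⊗-zeroʳ V.0ᴹ)))

  ∑-⊗ : ∀ {n} (v : Vector V.Carrierᴹ n) c → LV.∑ v ⊗ c ≈⊗ LT.∑ (λ k → v k ⊗ c)
  ∑-⊗ {zero}  v c = 0⊗ c
  ∑-⊗ {suc n} v c = transᵗ (⊗-distʳ _ _ c) (⊕-cong reflᵗ (∑-⊗ (v ∘ suc) c))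

  ⊗ˢ-+ : ∀ W {x y} → (W ⊗ˢ) x → (W ⊗ˢ) y → (W ⊗ˢ) (x ⊕ y)
  ⊗ˢ-+ W (m , u , c , u∈ , x≈) (n , v , d , v∈ , y≈) =
    m ℕ.+ n , u ++ v , c ++ d , ++-all {P = _∈ˢ W} u v u∈ v∈ ,
    transᵗ (⊕-cong x≈ y≈) (transᵗ (symᵗ (ST.∑-++ (λ k → u k ⊗ c k) (λ k → v k ⊗ d k))) (ST.sum-cong-≋ zip))
    where
    zip : ∀ k → ((λ k → u k ⊗ c k) ++ (λ k → v k ⊗ d k)) k ≈⊗ (u ++ v) k ⊗ (c ++ d) k
    zip k with splitAt m k
    ... | inj₁ _ = reflᵗ
    ... | inj₂ _ = reflᵗ

  module _ {f : V.Carrierᴹ → V.Carrierᴹ} (f-linear : LinearMap V V f) where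
    private module f = IsModuleHomomorphism f-linear

    ⊗id-cong : ∀ {x y} → x ≈⊗ y → (f ⊗id) x ≈⊗ (f ⊗id) y
    ⊗id-cong reflᵗ = reflᵗ
    ⊗id-cong (symᵗ p) = symᵗ (⊗id-cong p)
    ⊗id-cong (transᵗ p q) = transᵗ (⊗id-cong p) (⊗id-cong q)
    ⊗id-cong (⊕-cong p q) = ⊕-cong (⊗id-cong p) (⊗id-cong q)
    ⊗id-cong (⊕-assoc x y z) = ⊕-assoc _ _ _
    ⊗id-cong (⊕-comm x y) = ⊕-comm _ _
    ⊗id-cong (⊕-idˡ x) = ⊕-idˡ _
    ⊗id-cong (⊗-cong p q) = ⊗-cong (f.⟦⟧-cong p) q
    ⊗id-cong (⊗-zeroʳ v) = ⊗-zeroʳ _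
    ⊗id-cong (⊗-distˡ v c d) = ⊗-distˡ _ _ _
    ⊗id-cong (⊗-distʳ v w c) = transᵗ (⊗-cong (f.+ᴹ-homo v w) S.refl) (⊗-distʳ _ _ _)
    ⊗id-cong (⊗-balance r v c) = transᵗ (⊗-cong (f.*ₗ-homo r v) S.refl) (⊗-balance _ _ _)

    ⊗id-* : ∀ s x → (f ⊗id) (s • x) ≈⊗ s • (f ⊗id) x
    ⊗id-* s 𝟎 = reflᵗ
    ⊗id-* s (v ⊗ c) = reflᵗ
    ⊗id-* s (x ⊕ y) = ⊕-cong (⊗id-* s x) (⊗id-* s y)

    ⊗id-linear : LinearMap tensorModule tensorModule (f ⊗id)
    ⊗id-linear = mkLinear tensorModule tensorModule (f ⊗id) ⊗id-cong (λ x y → reflᵗ) ⊗id-*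

  module _ {f : V.Carrierᴹ → R.Carrier} (f-linear : LinearMap V scalars f) where
    private module f = IsModuleHomomorphism f-linear

    extend-* : ∀ s x → extend f (s • x) S.≈ s S.* extend f x
    extend-* s 𝟎 = S.sym (S.zeroʳ s)
    extend-* s (v ⊗ c) = S.trans (S.sym (S.*-assoc _ _ _)) (S.trans (S.*-congʳ (S.*-comm _ _)) (S.*-assoc _ _ _))
    extend-* s (x ⊕ y) = S.trans (S.+-cong (extend-* s x) (extend-* s y)) (S.sym (S.distribˡ s _ _))

    extend-linear : LinearMap tensorModule scalars (extend f)
    extend-linear = mkLinear tensorModule scalars (extend f)
      (extend-cong f f.⟦⟧-cong f.+ᴹ-homo f.*ₗ-homo) (λ x y → S.refl) extend-*

    extend-kills : ∀ W → (∀ {v} → v ∈ˢ W → f v R.≈ R.0#) → ∀ {x} → (W ⊗ˢ) x → extend f x S.≈ S.0#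
    extend-kills W fW≈0 (n , v , c , v∈ , x≈) = S.trans (⟦⟧-cong x≈)
      (S.trans (LinearMapSums.∑-homo tensorModule scalars extend-linear (λ k → v k ⊗ c k)) (Combinations.∑-zero (scalars {R = S}) _ λ k →
        S.trans (S.*-congʳ (S.trans (φ.⟦⟧-cong (fW≈0 (v∈ k))) φ.0#-homo)) (S.zeroˡ _)))
      where open IsModuleHomomorphism extend-linear using (⟦⟧-cong)

  -- The extended functionals read off the coefficients of the `w j ⊗ 1`. This is how linear
  -- independence survives extension of scalars, with no normal form for tensors.
  extend-dual : ∀ {n} {f : Fin n → V.Carrierᴹ → R.Carrier} → (∀ k → LinearMap V scalars (f k)) →
    (w : Vector V.Carrierᴹ n) → (∀ k → f k (w k) R.≈ R.1#) → (∀ {j k} → j ≢ k → f k (w j) R.≈ R.0#) →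
    ∀ z k → extend (f k) (LT.combination z (λ j → w j ⊗ S.1#)) S.≈ z k
  extend-dual {f = f} f-linear w f-≡ f-≢ z k = begin
    extend (f k) (LT.combination z (λ j → w j ⊗ S.1#))
      ≈⟨ LinearMapSums.combination-homo tensorModule scalars (extend-linear (f-linear k)) z (λ j → w j ⊗ S.1#) ⟩
    LS.combination z (λ j → φ.⟦ f k (w j) ⟧ S.* S.1#)
      ≈⟨ Combinations.∑-single (scalars {R = S}) (λ j → z j S.* (φ.⟦ f k (w j) ⟧ S.* S.1#)) k (λ j j≢k →
           S.trans (S.*-congˡ (S.trans (S.*-congʳ (S.trans (φ.⟦⟧-cong (f-≢ j≢k)) φ.0#-homo)) (S.zeroˡ _))) (S.zeroʳ _)) ⟩
    z k S.* (φ.⟦ f k (w k) ⟧ S.* S.1#)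
      ≈⟨ S.*-congˡ (S.trans (S.*-identityʳ _) (S.trans (φ.⟦⟧-cong (f-≡ k)) φ.1#-homo)) ⟩
    z k S.* S.1#    ≈⟨ S.*-identityʳ _ ⟩
    z k             ∎
    where
    module LS = LinearAlgebra (scalars {R = S})
    open SetoidReasoning S.setoid

  module _ {n : ℕ} {f : Fin n → V.Carrierᴹ → R.Carrier} (w : Vector V.Carrierᴹ n) (p : V.Carrierᴹ → V.Carrierᴹ)
           (p≈fw : ∀ v → p v V.≈ᴹ LV.combination (λ k → f k v) w) where
    -- The spanning counterpart of `extend-dual`. With `p` the averaging projector it expands fixed
    -- vectors in a basis of V⁺; with `p` projecting along Fil⁰ it turns the vanishing of
    -- functionals into membership in Fil⁰ ⊗ ℂ.
    ⊗id-combination : ∀ x → (p ⊗id) x ≈⊗ LT.combination (λ k → extend (f k) x) (λ k → w k ⊗ S.1#)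
    ⊗id-combination 𝟎 = symᵗ (ST.combination-zeroˡ (λ _ → S.0#) (λ k → w k ⊗ S.1#) λ _ → S.refl)
    ⊗id-combination (v ⊗ c) = transᵗ (⊗-cong (p≈fw v) S.refl) (transᵗ (∑-⊗ (λ k → f k v V.*ₗ w k) c)
      (ST.sum-cong-≋ λ k → transᵗ (⊗-balance (f k v) (w k) c) (⊗-cong V.≈ᴹ-refl (S.sym (S.*-identityʳ _)))))
    ⊗id-combination (x ⊕ y) = transᵗ (⊕-cong (⊗id-combination x) (⊗id-combination y))
      (symᵗ (ST.combination-+ˡ (λ k → extend (f k) x) (λ k → extend (f k) y) (λ k → w k ⊗ S.1#)))

  ⊗id-complement : ∀ W {p : V.Carrierᴹ → V.Carrierᴹ} → (∀ v → ∃ λ w → w ∈ˢ W × v V.≈ᴹ p v V.+ᴹ w) →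
    ∀ x → ∃ λ y → (W ⊗ˢ) y × x ≈⊗ (p ⊗id) x ⊕ y
  ⊗id-complement W split 𝟎 = 𝟎 , (0 , (λ ()) , (λ ()) , (λ ()) , reflᵗ) , symᵗ (⊕-idˡ 𝟎)
  ⊗id-complement W split (v ⊗ c) = let w , w∈W , v≈ = split v in
    w ⊗ c , (1 , (λ _ → w) , (λ _ → c) , (λ _ → w∈W) , symᵗ (transᵗ (⊕-comm _ _) (⊕-idˡ _))) ,
    transᵗ (⊗-cong v≈ S.refl) (⊗-distʳ _ _ c)
  ⊗id-complement W {p} split (x ⊕ y) =
    let x′ , x′∈W , x≈ = ⊗id-complement W split x
        y′ , y′∈W , y≈ = ⊗id-complement W split y
    in x′ ⊕ y′ , ⊗ˢ-+ W x′∈W y′∈W , transᵗ (⊕-cong x≈ y≈) (ST.+ᴹ-interchange ((p ⊗id) x) x′ ((p ⊗id) y) y′)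

module _ {R : CRing} (V : Mod R) (W : Submodule V) where
  private module V = Module V

  inclusion-linear : LinearMap (subModule V W) V proj₁
  inclusion-linear = mkLinear (subModule V W) V proj₁ id (λ _ _ → V.≈ᴹ-refl) (λ _ _ → V.≈ᴹ-refl)

  projection-linear : LinearMap V (quotient V W) id
  projection-linear = mkLinear V (quotient V W) id
    (λ x≈y → V.0ᴹ , Submodule.0-closed W , V.≈ᴹ-trans x≈y (V.≈ᴹ-sym (V.+ᴹ-identityʳ _)))
    (λ _ _ → Module.≈ᴹ-refl (quotient V W)) (λ _ _ → Module.≈ᴹ-refl (quotient V W))

-- The period map of a premotivic structure

module PeriodMap (em : ExcludedMiddle 0ℓ) (ℂ : CRing) (ℂ-zeroOrUnit : ZeroOrUnit ℂ) (ℂ-nonZero : NonZeroRing ℂ)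
         (K : NumberField ℂ) (E-zeroOrUnit : ZeroOrUnit (NumberField.E-ring K))
         (half : HasHalf (NumberField.E-ring K))
         (M : Premotivic.PremotivicStructure ℂ K) where
  open Premotivic ℂ K hiding (module ℂ)
  open NumberField K
  open PremotivicStructure M
  private
    module ℂ = CommutativeRing ℂ
    module E = CommutativeRing E-ring
    module embed = RingHomomorphism embed
    ½ = proj₁ half
    ½+½≈1 = proj₂ half
    module F∞ = IsModuleHomomorphism F∞-linear
    module T = Module (H-B ⊗ℂ)
    module T′ = Module (H-dR ⊗ℂ)
    module LT = LinearAlgebra (H-B ⊗ℂ)
    module LT′ = LinearAlgebra (H-dR ⊗ℂ)
    module ST = Combinations (H-B ⊗ℂ)
    module ST′ = Combinations (H-dR ⊗ℂ)
    module MB = TensorMaps E-ring ℂ embed H-B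
    module MdR = TensorMaps E-ring ℂ embed H-dR

    H² : ℤ × ℤ → Submodule (H-B ⊗ℂ)
    H² (p , q) = H p q
    module DS = DirectSums (H-B ⊗ℂ) (≡-dec ℤₚ._≟_ ℤₚ._≟_) H²

    F∞ᶜ : Bℂ.Tensor → Bℂ.Tensor
    F∞ᶜ = F∞ Bℂ.⊗id
    F∞ᶜ-linear : LinearMap (H-B ⊗ℂ) (H-B ⊗ℂ) F∞ᶜ
    F∞ᶜ-linear = MB.⊗id-linear F∞-linear
    module F∞ᶜ = IsModuleHomomorphism F∞ᶜ-linear

    F∞ᶜ-involutive : ∀ x → F∞ᶜ (F∞ᶜ x) T.≈ᴹ x
    F∞ᶜ-involutive Bℂ.𝟎 = Bℂ.reflᵗ
    F∞ᶜ-involutive (v Bℂ.⊗ c) = Bℂ.⊗-cong (F∞-involutive v) ℂ.refl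
    F∞ᶜ-involutive (x Bℂ.⊕ y) = Bℂ.⊕-cong (F∞ᶜ-involutive x) (F∞ᶜ-involutive y)

  -- An involution is injective, and `F∞ᶜ` maps H^{p,q} into H^{q,p}. Hence the types with p > q can
  -- be settled by looking at their mirror images.
  exchange-vanishing : ∀ {p q} → (∀ {x} → x ∈ˢ H q p → x T.≈ᴹ T.0ᴹ) → ∀ {x} → x ∈ˢ H p q → x T.≈ᴹ T.0ᴹ
  exchange-vanishing {p} {q} H≈0 {x} x∈H = T.≈ᴹ-trans (T.≈ᴹ-sym (F∞ᶜ-involutive x))
    (F∞ᶜ.⟦⟧-cong (H≈0 (F∞-exchanges p q x∈H)))

  -- Applying F_∞ twice to a basis vector gives back the vector, multiplied by c². Its own
  -- coordinate is 1, so taking coordinates cancels the vector.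
  scalar-square : ∀ {k n c} → HasDimension (subModule (H-B ⊗ℂ) (H k k)) n → n ≢ 0 →
    (∀ x → x ∈ˢ H k k → F∞ᶜ x T.≈ᴹ c T.*ₗ x) → c ℂ.* c ℂ.≈ ℂ.1#
  scalar-square {n = zero} _ n≢0 _ = ⊥-elim (n≢0 ≡.refl)
  scalar-square {k} {suc n} {c} (v , v-basis) _ F≈c = begin
    c ℂ.* c                                ≈⟨ ℂ.*-identityʳ _ ⟨
    c ℂ.* c ℂ.* ℂ.1#                       ≈⟨ ℂ.*-congˡ (C.coord-basis-≡ zero) ⟨
    c ℂ.* c ℂ.* C.coord zero v₀            ≈⟨ coord.*ₗ-homo (c ℂ.* c) v₀ ⟨
    C.coord zero ((c ℂ.* c) Hᵏᵏ.*ₗ v₀)     ≈⟨ coord.⟦⟧-cong ccv≈v ⟩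
    C.coord zero v₀                        ≈⟨ C.coord-basis-≡ zero ⟩
    ℂ.1#                                   ∎
    where
    open SetoidReasoning ℂ.setoid
    module C = Coordinates (subModule (H-B ⊗ℂ) (H k k)) v v-basis
    module Hᵏᵏ = Module (subModule (H-B ⊗ℂ) (H k k))
    module coord = IsModuleHomomorphism (C.coord-linear zero)
    v₀ = v zero
    x = proj₁ v₀
    ccv≈v : (c ℂ.* c) T.*ₗ x T.≈ᴹ x
    ccv≈v = T.≈ᴹ-trans (T.*ₗ-assoc c c x) (T.≈ᴹ-trans (T.*ₗ-congˡ {c} (T.≈ᴹ-sym (F≈c x (proj₂ v₀))))
      (T.≈ᴹ-trans (T.≈ᴹ-sym (F∞ᶜ.*ₗ-homo c x)) (T.≈ᴹ-trans (F∞ᶜ.⟦⟧-cong (T.≈ᴹ-sym (F≈c x (proj₂ v₀)))) (F∞ᶜ-involutive x))))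

  -- A type that does not occur obeys no inequality, hence the separate first case. Of the rest,
  -- `q<0≤p` lies in Fil⁰, `p<0≤q` is exchanged with it by F_∞, and `fixed` lies outside Fil⁰ but
  -- already in the fixed space.
  data HodgeCase (p q : ℤ) : Set where
    vanishing : (∀ {x} → x ∈ˢ H p q → x T.≈ᴹ T.0ᴹ) → HodgeCase p q
    p<0≤q     : p ℤ.< 0ℤ → 0ℤ ℤ.≤ q → HodgeCase p q
    q<0≤p     : q ℤ.< 0ℤ → 0ℤ ℤ.≤ p → HodgeCase p q
    fixed     : p ℤ.< 0ℤ → (∀ {x} → x ∈ˢ H p q → F∞ᶜ x T.≈ᴹ x) → HodgeCase p q

  -- Fixed vectors of F_∞ as a complement of Fil⁰

  module PeriodDecomposition (hodgeCase : ∀ p q → HodgeCase p q) where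
    private
      0≤p : Pred (ℤ × ℤ) 0ℓ
      0≤p (p , _) = 0ℤ ℤ.≤ p

      Split : Bℂ.Tensor → Set
      Split x = ∃ λ x⁺ → ∃ λ y → F∞ᶜ x⁺ T.≈ᴹ x⁺ × y ∈ HodgeFil 0ℤ × x T.≈ᴹ x⁺ T.+ᴹ y

      split-summand : ∀ p q {x} → x ∈ˢ H p q → Split x
      split-summand p q {x} x∈H with hodgeCase p q
      ... | vanishing H≈0 = T.0ᴹ , T.0ᴹ , T.≈ᴹ-refl , DS.SumOver-0 {0≤p} , T.≈ᴹ-trans (H≈0 x∈H) (T.≈ᴹ-sym (T.+ᴹ-identityʳ _))
      ... | q<0≤p q<0 p≥0 = T.0ᴹ , x , T.≈ᴹ-refl , DS.SumOver-single {0≤p} p≥0 x∈H , T.≈ᴹ-sym (T.+ᴹ-identityˡ _)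
      ... | fixed p<0 Fx≈x = x , T.0ᴹ , Fx≈x x∈H , DS.SumOver-0 {0≤p} , T.≈ᴹ-sym (T.+ᴹ-identityʳ _)
      -- The involution fixes x + F_∞ x, and the correction -F_∞ x lies in H^{q,p}, inside Fil⁰
      -- because 0 ≤ q. Negation in this module is scaling by -1, so closure under scalars covers
      -- the sign.
      ... | p<0≤q p<0 0≤q = x T.+ᴹ F∞ᶜ x , T.-ᴹ (F∞ᶜ x) ,
            T.≈ᴹ-trans (T.+ᴹ-congˡ (F∞ᶜ-involutive x)) (T.+ᴹ-comm _ _) ,
            DS.SumOver-single {0≤p} 0≤q (Submodule.*ₗ-closed (H q p) (ℂ.- ℂ.1#) (F∞-exchanges p q x∈H)) ,
            T.≈ᴹ-sym (T.≈ᴹ-trans (T.+ᴹ-assoc _ _ _) (T.≈ᴹ-trans (T.+ᴹ-congˡ (T.-ᴹ‿inverseʳ _)) (T.+ᴹ-identityʳ _)))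

      split-sum : ∀ {n} (i : Vector (ℤ × ℤ) n) (v : Vector Bℂ.Tensor n) → (∀ k → v k ∈ˢ H² (i k)) → Split (LT.∑ v)
      split-sum {zero}  i v v∈ = T.0ᴹ , T.0ᴹ , T.≈ᴹ-refl , DS.SumOver-0 {0≤p} , T.≈ᴹ-sym (T.+ᴹ-identityʳ _)
      split-sum {suc n} i v v∈ =
        let x⁺ , y , Fx⁺ , y∈ , x≈ = split-summand (proj₁ (i zero)) (proj₂ (i zero)) (v∈ zero)
            z⁺ , w , Fz⁺ , w∈ , z≈ = split-sum (i ∘ suc) (v ∘ suc) (v∈ ∘ suc)
        in x⁺ T.+ᴹ z⁺ , y T.+ᴹ w , T.+ᴹ-cong Fx⁺ Fz⁺ , DS.SumOver-+ {0≤p} y∈ w∈ ,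
           T.≈ᴹ-trans (T.+ᴹ-cong x≈ z≈) (ST.+ᴹ-interchange x⁺ y z⁺ w)

    fixed+Fil⁰ : ∀ x → Split x
    fixed+Fil⁰ x = let n , i , v , _ , v∈ , x≈v = LinearAlgebra.IsDirectSum.spans Hodge-decomp x
                       x⁺ , y , Fx⁺ , y∈ , v≈ = split-sum i v v∈
                   in x⁺ , y , Fx⁺ , y∈ , T.≈ᴹ-trans x≈v v≈

    -- Among the types with 0 ≤ p, only those with q < 0 can carry a non-zero vector. Applying F_∞
    -- to the resulting expansion of x gives a second expansion of the same x, over types with p < 0
    -- ≤ q, and the two index sets are disjoint.
    fixed∩Fil⁰ : ∀ {x} → F∞ᶜ x T.≈ᴹ x → x ∈ HodgeFil 0ℤ → x T.≈ᴹ T.0ᴹ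
    fixed∩Fil⁰ {x} Fx≈x x∈ = DS.disjoint⇒0 Hodge-decomp
      (λ _ (_ , q<0) (0≤q , _) → ℤₚ.<⇒≱ q<0 0≤q) x-sum (exchange x-sum)
      where
      refine : ∀ pq → 0≤p pq →
        (0ℤ ℤ.≤ proj₁ pq × proj₂ pq ℤ.< 0ℤ) ⊎ (∀ {x} → x ∈ˢ H² pq → x T.≈ᴹ T.0ᴹ)
      refine (p , q) p≥0 with hodgeCase p q
      ... | vanishing H≈0 = inj₂ H≈0
      ... | p<0≤q p<0 _   = ⊥-elim (ℤₚ.<⇒≱ p<0 p≥0)
      ... | q<0≤p q<0 _   = inj₁ (p≥0 , q<0)
      ... | fixed p<0 _   = ⊥-elim (ℤₚ.<⇒≱ p<0 p≥0)
      x-sum = DS.collect {0≤p} refine x∈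
      exchange : DS.DistinctSumOver (λ (p , q) → 0ℤ ℤ.≤ p × q ℤ.< 0ℤ) x →
                 DS.DistinctSumOver (λ (p , q) → 0ℤ ℤ.≤ q × p ℤ.< 0ℤ) x
      exchange (DS.distinctSum i i-inj v i∈ v∈ x≈v) =
        DS.distinctSum (swap ∘ i) (λ eq → i-inj (≡.cong swap eq)) (F∞ᶜ ∘ v) i∈
          (λ k → F∞-exchanges _ _ (v∈ k))
          (T.≈ᴹ-trans (T.≈ᴹ-sym Fx≈x) (T.≈ᴹ-trans (F∞ᶜ.⟦⟧-cong x≈v)
            (LinearMapSums.∑-homo (H-B ⊗ℂ) (H-B ⊗ℂ) F∞ᶜ-linear v)))

  -- The eigenspace and the quotient over E, and the equality of their dimensions

  private
    H⁺ : Mod E-ring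
    H⁺ = subModule H-B (fixedSpace H-B F∞ F∞-linear)

    -- The projector onto the +1-eigenspace. Being defined over E it commutes with extension of
    -- scalars, so a vector of H_B ⊗ ℂ fixed by F_∞ ⊗ id comes from V⁺.
    average : B.Carrierᴹ → B.Carrierᴹ
    average x = ½ B.*ₗ (x B.+ᴹ F∞ x)

    average-fixed : ∀ x → F∞ (average x) B.≈ᴹ average x
    average-fixed x = B.≈ᴹ-trans (F∞.*ₗ-homo ½ _) (B.*ₗ-congˡ
      (B.≈ᴹ-trans (F∞.+ᴹ-homo x (F∞ x)) (B.≈ᴹ-trans (B.+ᴹ-congˡ (F∞-involutive x)) (B.+ᴹ-comm _ _))))

    average-id : ∀ {x} → F∞ x B.≈ᴹ x → average x B.≈ᴹ x
    average-id {x} Fx≈x = begin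
      ½ B.*ₗ (x B.+ᴹ F∞ x)           ≈⟨ B.*ₗ-congˡ (B.+ᴹ-congˡ Fx≈x) ⟩
      ½ B.*ₗ (x B.+ᴹ x)              ≈⟨ B.*ₗ-distribˡ ½ x x ⟩
      ½ B.*ₗ x B.+ᴹ ½ B.*ₗ x         ≈⟨ B.*ₗ-distribʳ x ½ ½ ⟨
      (½ E.+ ½) B.*ₗ x               ≈⟨ B.*ₗ-congʳ ½+½≈1 ⟩
      E.1# B.*ₗ x                    ≈⟨ B.*ₗ-identityˡ x ⟩
      x                              ∎
      where open SetoidReasoning B.≈ᴹ-setoid

    toH⁺ : B.Carrierᴹ → Module.Carrierᴹ H⁺
    toH⁺ x = average x , average-fixed x

    toH⁺-linear : LinearMap H-B H⁺ toH⁺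
    toH⁺-linear = mkLinear H-B H⁺ toH⁺
      (λ p → B.*ₗ-congˡ (B.+ᴹ-cong p (F∞.⟦⟧-cong p)))
      (λ x y → B.≈ᴹ-trans (B.*ₗ-congˡ (B.≈ᴹ-trans (B.+ᴹ-congˡ (F∞.+ᴹ-homo x y)) (Combinations.+ᴹ-interchange H-B x y (F∞ x) (F∞ y))))
        (B.*ₗ-distribˡ ½ _ _))
      (λ r x → begin
        ½ B.*ₗ (r B.*ₗ x B.+ᴹ F∞ (r B.*ₗ x))      ≈⟨ B.*ₗ-congˡ (B.+ᴹ-congˡ (F∞.*ₗ-homo r x)) ⟩
        ½ B.*ₗ (r B.*ₗ x B.+ᴹ r B.*ₗ F∞ x)        ≈⟨ B.*ₗ-congˡ (B.*ₗ-distribˡ r x (F∞ x)) ⟨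
        ½ B.*ₗ (r B.*ₗ (x B.+ᴹ F∞ x))             ≈⟨ B.*ₗ-assoc _ _ _ ⟨
        (½ E.* r) B.*ₗ (x B.+ᴹ F∞ x)              ≈⟨ B.*ₗ-congʳ (E.*-comm ½ r) ⟩
        (r E.* ½) B.*ₗ (x B.+ᴹ F∞ x)              ≈⟨ B.*ₗ-assoc _ _ _ ⟩
        r B.*ₗ (½ B.*ₗ (x B.+ᴹ F∞ x))             ∎)
      where
      open SetoidReasoning B.≈ᴹ-setoid

    averageᶜ : ∀ x → (average Bℂ.⊗id) x T.≈ᴹ embed.⟦ ½ ⟧ T.*ₗ (x T.+ᴹ F∞ᶜ x)
    averageᶜ Bℂ.𝟎 = T.≈ᴹ-sym (T.+ᴹ-identityˡ _)
    averageᶜ (v Bℂ.⊗ c) = T.≈ᴹ-trans (Bℂ.⊗-balance ½ (v B.+ᴹ F∞ v) c) (Bℂ.⊗-distʳ v (F∞ v) _)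
    averageᶜ (x Bℂ.⊕ y) = T.≈ᴹ-trans (T.+ᴹ-cong (averageᶜ x) (averageᶜ y))
      (ST.+ᴹ-interchange (h T.*ₗ x) (h T.*ₗ F∞ᶜ x) (h T.*ₗ y) (h T.*ₗ F∞ᶜ y))
      where
      h = embed.⟦ ½ ⟧

    averageᶜ-id : ∀ {x} → F∞ᶜ x T.≈ᴹ x → (average Bℂ.⊗id) x T.≈ᴹ x
    averageᶜ-id {x} Fx≈x = begin
      (average Bℂ.⊗id) x             ≈⟨ averageᶜ x ⟩
      h T.*ₗ (x T.+ᴹ F∞ᶜ x)          ≈⟨ T.*ₗ-congˡ {h} {x T.+ᴹ F∞ᶜ x} {x T.+ᴹ x} (T.+ᴹ-congˡ Fx≈x) ⟩
      h T.*ₗ (x T.+ᴹ x)              ≈⟨ T.*ₗ-distribʳ x h h ⟨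
      (h ℂ.+ h) T.*ₗ x               ≈⟨ T.*ₗ-congʳ {x} (ℂ.trans (ℂ.sym (embed.+-homo ½ ½)) (ℂ.trans (embed.⟦⟧-cong ½+½≈1) embed.1#-homo)) ⟩
      ℂ.1# T.*ₗ x                    ≈⟨ T.*ₗ-identityˡ x ⟩
      x                              ∎
      where
      h = embed.⟦ ½ ⟧
      open SetoidReasoning T.≈ᴹ-setoid

    Q : Mod E-ring
    Q = quotient H-dR (Fil 0ℤ)

    H⁺-finite : FiniteDimensional H⁺
    H⁺-finite = let _ , u , _ , u-spans = finite-B in
      spanning⇒finiteDimensional em E-zeroOrUnit H⁺ (toH⁺ ∘ u)
        (LinearMapSums.surjective⇒spanning H-B H⁺ toH⁺-linear (λ (x , Fx≈x) → x , average-id Fx≈x) u-spans)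

    Q-finite : FiniteDimensional Q
    Q-finite = let _ , u , _ , u-spans = finite-dR in
      spanning⇒finiteDimensional em E-zeroOrUnit Q u
        (LinearMapSums.surjective⇒spanning H-dR Q (projection-linear H-dR (Fil 0ℤ)) (λ x → x , Module.≈ᴹ-refl Q) u-spans)

  -- The period matrix (η k (φ (v j ⊗ 1))) is square: were it underdetermined, a nontrivial solution would
  -- contradict the injectivity (d ≤ e) or the surjectivity (e ≤ d) of V⁺ ⊗ ℂ → (H_dR / Fil⁰) ⊗ ℂ.
  module _ (hodgeCase : ∀ p q → HodgeCase p q)
           {d : ℕ} (v : Vector (Module.Carrierᴹ H⁺) d) (v-basis : LinearAlgebra.IsBasis H⁺ v)
           {e : ℕ} (w : Vector dR.Carrierᴹ e) (w-basis : LinearAlgebra.IsBasis Q w) where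
    open PeriodDecomposition hodgeCase
    private
      module C⁺ = Coordinates H⁺ v v-basis
      module CQ = Coordinates Q w w-basis
      module φ-iso = IsModuleIsomorphism comparison-iso
      φ-linear : LinearMap (H-B ⊗ℂ) (H-dR ⊗ℂ) comparison
      φ-linear = φ-iso.isModuleHomomorphism
      module φ = IsModuleHomomorphism φ-linear

      vᶜ : Vector Bℂ.Tensor d
      vᶜ j = proj₁ (v j) Bℂ.⊗ ℂ.1#
      wᶜ : Vector dRℂ.Tensor e
      wᶜ k = w k dRℂ.⊗ ℂ.1#

      -- Coordinates on V⁺ are pulled back along the projector to all of H_B, so that their
      -- extensions are functionals on `H-B ⊗ℂ` itself.
      f⁺ : Fin d → B.Carrierᴹ → E.Carrier
      f⁺ j = C⁺.coord j ∘ toH⁺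
      f⁺-linear : ∀ j → LinearMap H-B scalars (f⁺ j)
      f⁺-linear j = ∘-linear H-B H⁺ scalars (C⁺.coord-linear j) toH⁺-linear
      fQ-linear : ∀ k → LinearMap H-dR scalars (CQ.coord k)
      fQ-linear k = ∘-linear H-dR Q scalars (CQ.coord-linear k) (projection-linear H-dR (Fil 0ℤ))

      ξ : Fin d → Bℂ.Tensor → ℂ.Carrier
      ξ j = Bℂ.extend (f⁺ j)
      ξ-linear : ∀ j → LinearMap (H-B ⊗ℂ) scalars (ξ j)
      ξ-linear j = MB.extend-linear (f⁺-linear j)
      η : Fin e → dRℂ.Tensor → ℂ.Carrier
      η k = dRℂ.extend (CQ.coord k)
      η-linear : ∀ k → LinearMap (H-dR ⊗ℂ) scalars (η k)
      η-linear k = MdR.extend-linear (fQ-linear k)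
      ηφ-linear : ∀ k → LinearMap (H-B ⊗ℂ) scalars (η k ∘ comparison)
      ηφ-linear k = ∘-linear (H-B ⊗ℂ) (H-dR ⊗ℂ) scalars (η-linear k) φ-linear
      module η (k : Fin e) = IsModuleHomomorphism (η-linear k)

      ξ-dual : ∀ z j → ξ j (LT.combination z vᶜ) ℂ.≈ z j
      ξ-dual = MB.extend-dual f⁺-linear (proj₁ ∘ v)
        (λ j → E.trans (v-average j j) (C⁺.coord-basis-≡ j))
        (λ {j} {k} j≢k → E.trans (v-average j k) (C⁺.coord-basis-≢ j≢k))
        where
        v-average : ∀ j k → f⁺ k (proj₁ (v j)) E.≈ C⁺.coord k (v j)
        v-average j k = IsModuleHomomorphism.⟦⟧-cong (C⁺.coord-linear k) (average-id (proj₂ (v j)))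

      η-dual : ∀ z k → η k (LT′.combination z wᶜ) ℂ.≈ z k
      η-dual = MdR.extend-dual fQ-linear w CQ.coord-basis-≡ CQ.coord-basis-≢

      fixed-expansion : ∀ {x} → F∞ᶜ x T.≈ᴹ x → x T.≈ᴹ LT.combination (λ j → ξ j x) vᶜ
      fixed-expansion {x} Fx≈x = T.≈ᴹ-trans (T.≈ᴹ-sym (averageᶜ-id Fx≈x))
        (MB.⊗id-combination {f = f⁺} (proj₁ ∘ v) average (λ u →
          B.≈ᴹ-trans (C⁺.combination-coord (toH⁺ u))
            (LinearMapSums.combination-homo H⁺ H-B (inclusion-linear H-B (fixedSpace H-B F∞ F∞-linear)) (λ j → f⁺ j u) v)) x)

      -- The map `p` sends u to the representative of its class built from the `w k`. Extended to ℂ,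
      -- its value at y is the combination of the `wᶜ k` with coefficients `η k y`, so when these
      -- vanish only the part of y along Fil⁰ remains.
      Fil⁰-criterion : ∀ {y} → (∀ k → η k y ℂ.≈ ℂ.0#) → y ∈ (Fil 0ℤ dRℂ.⊗ˢ)
      Fil⁰-criterion {y} ηy≈0 =
        -- Equality in the quotient unfolds to equality in H_dR up to an element of Fil⁰, so
        -- `CQ.combination-coord` is literally the splitting required here.
        let y′ , y′∈Fil , y≈ = MdR.⊗id-complement (Fil 0ℤ) {p} CQ.combination-coord y
        in dRℂ.⊗ˢ-resp (Fil 0ℤ) (T′.≈ᴹ-sym (T′.≈ᴹ-trans y≈ (T′.≈ᴹ-trans (T′.+ᴹ-congʳ
             (T′.≈ᴹ-trans (MdR.⊗id-combination {f = CQ.coord} w p (λ _ → dR.≈ᴹ-refl) y) (ST′.combination-zeroˡ (λ k → η k y) wᶜ ηy≈0)))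
             (T′.+ᴹ-identityˡ _)))) y′∈Fil
        where
        p : dR.Carrierᴹ → dR.Carrierᴹ
        p u = LinearAlgebra.combination H-dR (λ k → CQ.coord k u) w

      η-Fil⁰ : ∀ {x} → x ∈ HodgeFil 0ℤ → ∀ k → η k (comparison x) ℂ.≈ ℂ.0#
      η-Fil⁰ x∈ k = MdR.extend-kills (fQ-linear k) (Fil 0ℤ)
        (λ {u} u∈ → E.trans (IsModuleHomomorphism.⟦⟧-cong (CQ.coord-linear k) {u} {dR.0ᴹ} (u , u∈ , dR.≈ᴹ-sym (dR.+ᴹ-identityˡ u)))
          (IsModuleHomomorphism.0ᴹ-homo (CQ.coord-linear k)))
        (Hodge→Fil 0ℤ x∈)

    -- Each `wᶜ k` is lifted through the comparison and split into a fixed part `y⁺ k` and a part in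
    -- Fil⁰. Fixed vectors are determined by `d` coordinates, so for d < e some non-trivial z
    -- annihilates the combination of the `y⁺ k`. The combination of the `wᶜ k` then comes from
    -- Fil⁰, and the functionals `η k`, which vanish there, read off z = 0.
    d≮e : ¬ (d ℕ.< e)
    d≮e d<e =
      let z , zξ≈0 , k , zk≉0 = nontrivialSolution ℂ ℂ-zeroOrUnit ℂ-nonZero d<e (λ j k → ξ j (y⁺ k)) in
      zk≉0 (ℂ.trans (ℂ.sym (η-dual z k)) (ℂ.trans (η.⟦⟧-cong k (relation z zξ≈0)) (vanish z k)))
      where
      lift : Fin e → Bℂ.Tensor
      lift k = proj₁ (φ-iso.surjective (wᶜ k))
      y⁺ y⁰ : Vector Bℂ.Tensor e
      y⁺ k = proj₁ (fixed+Fil⁰ (lift k))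
      y⁰ k = proj₁ (proj₂ (fixed+Fil⁰ (lift k)))
      Fy⁺ : ∀ k → F∞ᶜ (y⁺ k) T.≈ᴹ y⁺ k
      Fy⁺ k = proj₁ (proj₂ (proj₂ (fixed+Fil⁰ (lift k))))
      y⁰∈ : ∀ k → y⁰ k ∈ HodgeFil 0ℤ
      y⁰∈ k = proj₁ (proj₂ (proj₂ (proj₂ (fixed+Fil⁰ (lift k)))))
      lift≈ : ∀ k → lift k T.≈ᴹ y⁺ k T.+ᴹ y⁰ k
      lift≈ k = proj₂ (proj₂ (proj₂ (proj₂ (fixed+Fil⁰ (lift k)))))
      wᶜ≈ : ∀ k → wᶜ k T′.≈ᴹ comparison (y⁺ k T.+ᴹ y⁰ k)
      wᶜ≈ k = T′.≈ᴹ-sym (proj₂ (φ-iso.surjective (wᶜ k)) (T.≈ᴹ-sym (lift≈ k)))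
      relation : ∀ z → (∀ j → LinearAlgebra.combination (scalars {R = ℂ}) z (λ k → ξ j (y⁺ k)) ℂ.≈ ℂ.0#) →
        LT′.combination z wᶜ T′.≈ᴹ comparison (LT.combination z y⁰)
      relation z zξ≈0 = begin
        LT′.combination z wᶜ                                    ≈⟨ ST′.combination-congʳ z wᶜ≈ ⟩
        LT′.combination z (λ k → comparison (y⁺ k T.+ᴹ y⁰ k))
          ≈⟨ LinearMapSums.combination-homo (H-B ⊗ℂ) (H-dR ⊗ℂ) φ-linear z (λ k → y⁺ k T.+ᴹ y⁰ k) ⟨
        comparison (LT.combination z (λ k → y⁺ k T.+ᴹ y⁰ k))    ≈⟨ φ.⟦⟧-cong (ST.combination-+ʳ z y⁺ y⁰) ⟩
        comparison (LT.combination z y⁺ T.+ᴹ LT.combination z y⁰)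
          ≈⟨ φ.⟦⟧-cong (T.≈ᴹ-trans (T.+ᴹ-congʳ zy⁺≈0) (T.+ᴹ-identityˡ _)) ⟩
        comparison (LT.combination z y⁰)                        ∎
        where
        open SetoidReasoning T′.≈ᴹ-setoid
        Fzy⁺ : F∞ᶜ (LT.combination z y⁺) T.≈ᴹ LT.combination z y⁺
        Fzy⁺ = T.≈ᴹ-trans (LinearMapSums.combination-homo (H-B ⊗ℂ) (H-B ⊗ℂ) F∞ᶜ-linear z y⁺)
          (ST.combination-congʳ z Fy⁺)
        zy⁺≈0 : LT.combination z y⁺ T.≈ᴹ T.0ᴹ
        zy⁺≈0 = T.≈ᴹ-trans (fixed-expansion Fzy⁺) (ST.combination-zeroˡ (λ j → ξ j (LT.combination z y⁺)) vᶜ λ j →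
          ℂ.trans (LinearMapSums.combination-homo (H-B ⊗ℂ) scalars (ξ-linear j) z y⁺) (zξ≈0 j))
      vanish : ∀ z k → η k (comparison (LT.combination z y⁰)) ℂ.≈ ℂ.0#
      vanish z k = ℂ.trans (LinearMapSums.combination-homo (H-B ⊗ℂ) scalars (ηφ-linear k) z y⁰)
        (Combinations.combination-zeroʳ (scalars {R = ℂ}) z (λ l → η k (comparison (y⁰ l))) λ l → η-Fil⁰ (y⁰∈ l) k)

    -- For e < d some non-trivial combination of the `vᶜ j` has vanishing class modulo Fil⁰. It is
    -- also fixed by F_∞, hence zero, and the functionals `ξ j` read off z = 0.
    e≮d : ¬ (e ℕ.< d)
    e≮d e<d =
      let z , zη≈0 , j , zj≉0 = nontrivialSolution ℂ ℂ-zeroOrUnit ℂ-nonZero e<d (λ k j → η k (comparison (vᶜ j))) in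
      zj≉0 (ℂ.trans (ℂ.sym (ξ-dual z j)) (ℂ.trans (ξ.⟦⟧-cong j (zvᶜ≈0 z zη≈0)) (ξ.0ᴹ-homo j)))
      where
      module ξ (j : Fin d) = IsModuleHomomorphism (ξ-linear j)
      zvᶜ≈0 : ∀ z → (∀ k → LinearAlgebra.combination (scalars {R = ℂ}) z (λ j → η k (comparison (vᶜ j))) ℂ.≈ ℂ.0#) →
        LT.combination z vᶜ T.≈ᴹ T.0ᴹ
      zvᶜ≈0 z zη≈0 = fixed∩Fil⁰
        (T.≈ᴹ-trans (LinearMapSums.combination-homo (H-B ⊗ℂ) (H-B ⊗ℂ) F∞ᶜ-linear z vᶜ)
          (ST.combination-congʳ z λ j → Bℂ.⊗-cong (proj₂ (v j)) ℂ.refl))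
        (Fil→Hodge 0ℤ (Fil⁰-criterion λ k →
          ℂ.trans (LinearMapSums.combination-homo (H-B ⊗ℂ) scalars (ηφ-linear k) z vᶜ) (zη≈0 k)))

  hodgeCases⇒critical : (∀ p q → HodgeCase p q) → IsCritical
  hodgeCases⇒critical hodgeCase with H⁺-finite | Q-finite
  ... | d , v , v-basis | e , w , w-basis = d , (v , v-basis) , ≡.subst (HasDimension Q) (≡.sym d≡e) (w , w-basis)
    where
    d≡e : d ≡ e
    d≡e = ℕₚ.≤-antisym (ℕₚ.≮⇒≥ (e≮d hodgeCase v v-basis w w-basis)) (ℕₚ.≮⇒≥ (d≮e hodgeCase v v-basis w w-basis))

-- Ordered fields

module _ (K : Field) where
  open CommutativeRing (fieldRing K)
  private
    module H = HeytingField K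

  -- If 1 = 0, all elements are equal and the difference 0 - 0 counts as invertible. Zero would then
  -- be apart from itself, against irreflexivity.
  field-nonZero : NonZeroRing (fieldRing K)
  field-nonZero 1≈0 = H.#-irrefl refl (H.invertible⇒# {0#} {0#} (0# , trivial _ _ , trivial _ _))
    where
    trivial : ∀ x y → x ≈ y
    trivial x y = trans (0≈ x) (sym (0≈ y))
      where
      0≈ : ∀ x → x ≈ 0#
      0≈ x = trans (sym (*-identityˡ x)) (trans (*-congʳ 1≈0) (zeroˡ x))

  field-zeroOrUnit : ExcludedMiddle 0ℓ → ZeroOrUnit (fieldRing K)
  field-zeroOrUnit em x with em {x H.# 0#}
  ... | no ¬x#0 = inj₁ (proj₁ (H.tight x 0#) ¬x#0)
  ... | yes x#0 = let y , _ , [x-0]y≈1 = H.#⇒invertible x#0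
                  in inj₂ (y , trans (*-congʳ (sym (trans (+-congˡ -0#≈0#) (+-identityʳ x)))) [x-0]y≈1)
    where open import Algebra.Properties.Ring ring using (-0#≈0#)

module _ (R : CRing) (zeroOrUnit : ZeroOrUnit R) where
  open CommutativeRing R
  open CRingSolver R using (solve; _:=_; _:+_; _:*_; _:-_; con)

  x*y≈0⇒x≈0⊎y≈0 : ∀ {x y} → x * y ≈ 0# → x ≈ 0# ⊎ y ≈ 0#
  x*y≈0⇒x≈0⊎y≈0 {x} {y} xy≈0 with zeroOrUnit x
  ... | inj₁ x≈0 = inj₁ x≈0
  ... | inj₂ (z , xz≈1) = inj₂ (trans (sym (*-identityˡ y)) (trans (*-congʳ (sym xz≈1))
        (trans (*-congʳ (*-comm x z)) (trans (*-assoc z x y) (trans (*-congˡ xy≈0) (zeroʳ z))))))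

  x²≈1⇒x≈±1 : ∀ {x} → x * x ≈ 1# → x ≈ 1# ⊎ x ≈ - 1#
  x²≈1⇒x≈±1 {x} x²≈1 with x*y≈0⇒x≈0⊎y≈0 {x - 1#} {x + 1#} (trans expand (trans (+-congʳ x²≈1) (-‿inverseʳ 1#)))
    where
    open IntegerCast R using (fromℤ)
    expand : (x - 1#) * (x + 1#) ≈ x * x - 1#
    -- The solver reads its constant 1 as `fromℤ 1ℤ`, which unfolds to `1# + 0#`; both ends of the
    -- identity are converted by `1≈`.
    expand = trans (*-cong (+-congˡ (-‿cong (sym 1≈))) (+-congˡ (sym 1≈)))
      (trans (solve 1 (λ x → (x :- con 1ℤ) :* (x :+ con 1ℤ) := x :* x :- con 1ℤ) refl x) (+-congˡ (-‿cong 1≈)))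
      where
      1≈ : fromℤ 1ℤ ≈ 1#
      1≈ = +-identityʳ 1#
  ... | inj₁ x-1≈0 = inj₁ (x∙y⁻¹≈ε⇒x≈y x 1# x-1≈0)
    where open import Algebra.Properties.Ring ring using (x∙y⁻¹≈ε⇒x≈y)
  ... | inj₂ x+1≈0 = inj₂ (inverseˡ-unique x 1# x+1≈0)
    where open import Algebra.Properties.AbelianGroup +-abelianGroup using (inverseˡ-unique)

module _ (em : ExcludedMiddle 0ℓ) (R : CRing) where
  open CommutativeRing R
  open Classical em

  recip-inverseʳ : ∀ {x} → (∃ λ y → x * y ≈ 1#) → x * recip R x ≈ 1#
  recip-inverseʳ {x} unit with em {∃ λ y → x * y ≈ 1#}
  ... | yes (y , xy≈1) = xy≈1
  ... | no  nonunit    = ⊥-elim (nonunit unit)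

module OrderedField (ℝ : CompleteOrderedField) where
  open CompleteOrderedField ℝ
  open CRingSolver ring′ using (solve; _:=_; _:+_; _:*_; _:-_; :-_; con)
  module ≤ = IsTotalOrder isTotalOrder

  0≤y-x⇒x≤y : ∀ {x y} → 0# ≤ y - x → x ≤ y
  0≤y-x⇒x≤y {x} {y} p = ≤.trans (≤.reflexive (sym (+-identityˡ x)))
    (≤.trans (+-monoˡ-≤ x p) (≤.reflexive (solve 2 (λ x y → y :- x :+ x := y) refl x y)))

  x≤y⇒0≤y-x : ∀ {x y} → x ≤ y → 0# ≤ y - x
  x≤y⇒0≤y-x {x} p = ≤.trans (≤.reflexive (sym (-‿inverseʳ x))) (+-monoˡ-≤ (- x) p)

  +-mono-≤ : ∀ {x y u v} → x ≤ y → u ≤ v → x + u ≤ y + v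
  +-mono-≤ {x} {y} {u} {v} p q = ≤.trans (+-monoˡ-≤ u p)
    (≤.trans (≤.reflexive (+-comm y u)) (≤.trans (+-monoˡ-≤ y q) (≤.reflexive (+-comm v y))))

  neg-mono-≤ : ∀ {x y} → x ≤ y → - y ≤ - x
  neg-mono-≤ {x} {y} p = 0≤y-x⇒x≤y (≤.trans (x≤y⇒0≤y-x p) (≤.reflexive (solve 2 (λ x y → y :- x := :- x :- (:- y)) refl x y)))

  0≤x² : ∀ x → 0# ≤ x * x
  0≤x² x with ≤.total 0# x
  ... | inj₁ 0≤x = *-nonNeg 0≤x 0≤x
  ... | inj₂ x≤0 = ≤.trans (*-nonNeg 0≤-x 0≤-x) (≤.reflexive (solve 1 (λ x → :- x :* :- x := x :* x) refl x))
    where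
    0≤-x : 0# ≤ - x
    0≤-x = ≤.trans (x≤y⇒0≤y-x x≤0) (≤.reflexive (+-identityˡ (- x)))

  0≤1 : 0# ≤ 1#
  0≤1 = ≤.trans (0≤x² 1#) (≤.reflexive (*-identityˡ 1#))

  1≰0 : ¬ (1# ≤ 0#)
  1≰0 1≤0 = field-nonZero field′ (≤.antisym 1≤0 0≤1)

  private module fromℤ = RingHomomorphism fromℤ-hom

  0≤fromℤ : ∀ n → 0# ≤ fromℤ (+ n)
  0≤fromℤ zero    = ≤.refl
  0≤fromℤ (suc n) = ≤.trans (≤.reflexive (sym (+-identityˡ 0#))) (+-mono-≤ 0≤1 (0≤fromℤ n))

  fromℤ-mono-≤ : ∀ {p q} → p ℤ.≤ q → fromℤ p ≤ fromℤ q
  fromℤ-mono-≤ {p} {q} p≤q with q ℤ.- p in eq | ℤₚ.i≤j⇒0≤j-i p≤q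
  ... | + n | _ = 0≤y-x⇒x≤y (≤.trans (0≤fromℤ n) (≤.reflexive
        (trans (reflexive (≡.cong fromℤ (≡.sym eq))) (trans (fromℤ.+-homo q (ℤ.- p)) (+-congˡ (fromℤ.-‿homo p))))))

  fromℤ-cancel-≤ : ∀ {p q} → fromℤ p ≤ fromℤ q → p ℤ.≤ q
  fromℤ-cancel-≤ {p} {q} P≤Q with p ℤₚ.≤? q
  ... | yes p≤q = p≤q
  ... | no  p≰q = ⊥-elim (1≰0 (≤.trans (≤.reflexive (solve 2 (λ x y → x := x :+ y :- y) refl 1# (fromℤ q)))
        (≤.trans (+-monoˡ-≤ (- fromℤ q) 1+Q≤Q) (≤.reflexive (-‿inverseʳ (fromℤ q))))))
    where
    1+Q≤Q : 1# + fromℤ q ≤ fromℤ q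
    1+Q≤Q = ≤.trans (≤.reflexive (sym (trans (fromℤ.+-homo 1ℤ q) (+-congʳ (+-identityʳ 1#)))))
      (≤.trans (fromℤ-mono-≤ (ℤₚ.i<j⇒suc[i]≤j (ℤₚ.≰⇒> p≰q))) P≤Q)

  fromℤ-injective : ∀ {p q} → fromℤ p ≈ fromℤ q → p ≡ q
  fromℤ-injective P≈Q = ℤₚ.≤-antisym (fromℤ-cancel-≤ (≤.reflexive P≈Q)) (fromℤ-cancel-≤ (≤.reflexive (sym P≈Q)))

  ℝ-invertible : ExcludedMiddle 0ℓ → ∀ {x} → ¬ (x ≈ 0#) → ∃ λ y → x * y ≈ 1#
  ℝ-invertible em {x} x≉0 with field-zeroOrUnit field′ em x
  ... | inj₁ x≈0  = ⊥-elim (x≉0 x≈0)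
  ... | inj₂ unit = unit

  fromℤ-unit : ExcludedMiddle 0ℓ → ∀ {n} → 1 ℕ.≤ n → ∃ λ y → fromℤ (+ n) * y ≈ 1#
  fromℤ-unit em {suc n} _ = ℝ-invertible em λ N≈0 → 1≰0 (≤.trans 1≤N (≤.reflexive N≈0))
    where
    1≤N : 1# ≤ fromℤ (+ suc n)
    1≤N = ≤.trans (≤.reflexive (sym (+-identityʳ 1#))) (+-mono-≤ ≤.refl (0≤fromℤ n))

  x²+y²≈0⇒x≈0 : ExcludedMiddle 0ℓ → ∀ x y → x * x + y * y ≈ 0# → x ≈ 0#
  x²+y²≈0⇒x≈0 em x y n≈0 with x*y≈0⇒x≈0⊎y≈0 ring′ (field-zeroOrUnit field′ em) {x} {x} (≤.antisym x²≤0 (0≤x² x))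
    where
    x²≤0 : x * x ≤ 0#
    x²≤0 = ≤.trans (≤.reflexive (sym (+-identityʳ _))) (≤.trans (+-mono-≤ ≤.refl (0≤x² y)) (≤.reflexive n≈0))
  ... | inj₁ x≈0 = x≈0
  ... | inj₂ x≈0 = x≈0

  ℂ-zeroOrUnit : ExcludedMiddle 0ℓ → ZeroOrUnit ℂ
  ℂ-zeroOrUnit em (x , y) with field-zeroOrUnit field′ em (x * x + y * y)
  ... | inj₁ n≈0 = inj₁ (x²+y²≈0⇒x≈0 em x y n≈0 , x²+y²≈0⇒x≈0 em y x (trans (+-comm _ _) n≈0))
  -- The inverse of x + iy is its conjugate divided by x² + y².
  ... | inj₂ (m , nm≈1) = inj₂ ((x * m , - (y * m)) ,
        trans (solve 3 (λ x y m → x :* (x :* m) :- y :* (:- (y :* m)) := (x :* x :+ y :* y) :* m) refl x y m) nm≈1 ,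
        solve 3 (λ x y m → x :* (:- (y :* m)) :+ y :* (x :* m) := con 0ℤ) refl x y m)

  ℂ-nonZero : NonZeroRing ℂ
  ℂ-nonZero (1≈0 , _) = field-nonZero field′ 1≈0

  -- Here a(cr - s) = c - as. With a = i this clears the denominator in s ≤ (b - 1)/i.
  s≤cr⇒as≤c : ∀ {a r c s} → 0# ≤ a → a * r ≈ 1# → s ≤ c * r → a * s ≤ c
  s≤cr⇒as≤c {a} {r} {c} {s} 0≤a ar≈1 s≤cr = 0≤y-x⇒x≤y (≤.trans (*-nonNeg 0≤a (x≤y⇒0≤y-x s≤cr)) (≤.reflexive
    (trans (solve 4 (λ a s c r → a :* (c :* r :- s) := c :* (a :* r) :- a :* s) refl a s c r)
      (+-congʳ (trans (*-congˡ ar≈1) (*-identityʳ c))))))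

  -- (p , q) is the entry for the motive before the Tate twist; the twist turns it into (p - 1 , q - 1).
  module HodgeEntry {i : ℕ} (1≤i : 1 ℕ.≤ i) {s x : Carrier} {p q : ℤ} (0<s : 0# < s)
           (p≈ : fromℤ p ≈ - x - fromℤ (+ i) * s) (q≈ : fromℤ q ≈ x - fromℤ (+ i) * s) where
    private
      is = fromℤ (+ i) * s

      s≤is : ∀ {i} → 1 ℕ.≤ i → s ≤ fromℤ (+ i) * s
      s≤is {suc n} _ = 0≤y-x⇒x≤y (≤.trans (*-nonNeg (0≤fromℤ n) (proj₁ 0<s)) (≤.reflexive
        (trans (solve 2 (λ n s → n :* s := s :+ n :* s :- s) refl (fromℤ (+ n)) s)
          (+-congʳ (trans (+-congʳ (sym (*-identityˡ s))) (sym (distribʳ s 1# (fromℤ (+ n)))))))))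

    -- The sum p + q is -2is, which is negative for s > 0, so both entries cannot be non-negative.
    -- The proof uses the form p + q + is = -is.
    p≤q⇒p<0 : p ℤ.≤ q → p ℤ.< 0ℤ
    p≤q⇒p<0 p≤q = ℤₚ.≰⇒> λ 0≤p → proj₂ 0<s (≤.antisym (proj₁ 0<s) (≤.trans (s≤is 1≤i) (is≤0 0≤p)))
      where
      is≤0 : 0ℤ ℤ.≤ p → is ≤ 0#
      is≤0 0≤p = 0≤y-x⇒x≤y (≤.trans (≤.trans (≤.reflexive (sym (+-identityˡ 0#)))
        (+-mono-≤ (≤.trans (≤.reflexive (sym (+-identityˡ 0#))) (+-mono-≤ (fromℤ-mono-≤ 0≤p) (fromℤ-mono-≤ (ℤₚ.≤-trans 0≤p p≤q))))
          (≤.trans (proj₁ 0<s) (s≤is 1≤i))))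
        (≤.reflexive (trans (+-congʳ (+-cong p≈ q≈))
          (solve 2 (λ x t → :- x :- t :+ (x :- t) :+ t := con 0ℤ :- t) refl x is))))

    -- The difference q - p is 2x. A positive pairing is what makes the minimality of `b`
    -- applicable.
    p<q⇒0<x : p ℤ.< q → 0# < x
    p<q⇒0<x p<q with ≤.total 0# x
    ... | inj₂ x≤0 = ⊥-elim (ℤₚ.<⇒≱ p<q (fromℤ-cancel-≤ (≤.trans (≤.reflexive q≈)
          (≤.trans (+-monoˡ-≤ (- is) (≤.trans x≤0 (≤.trans 0≤-0 (neg-mono-≤ x≤0)))) (≤.reflexive (sym p≈))))))
      where
      0≤-0 : 0# ≤ - 0#
      0≤-0 = ≤.reflexive (solve 0 (con 0ℤ := :- con 0ℤ) refl)
    ... | inj₁ 0≤x = 0≤x , λ 0≈x → ℤₚ.<⇒≢ p<q (fromℤ-injective (trans p≈ (trans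
          (+-congʳ (trans (-‿cong (sym 0≈x)) (trans (solve 0 (:- con 0ℤ := con 0ℤ) refl) 0≈x))) (sym q≈))))

    -- Here q = x - is is at least 1, so it remains non-negative when the Tate twist lowers it by 1.
    -- This accounts for the -1 in the bound (b - 1)/i.
    is≤x-1⇒0<q : is ≤ x - 1# → 0ℤ ℤ.< q
    is≤x-1⇒0<q is≤x-1 = ℤₚ.suc[i]≤j⇒i<j (fromℤ-cancel-≤ {1ℤ} {q} (≤.trans (≤.reflexive (+-identityʳ 1#))
      (0≤y-x⇒x≤y (≤.trans (x≤y⇒0≤y-x is≤x-1) (≤.reflexive
        (trans (solve 3 (λ x u t → x :- u :- t := x :- t :- u) refl x 1# is) (+-congʳ (sym q≈))))))))

  -- Adding the two equations removes x and gives 2(p + 1) = -2is, which is `wt + 2`. So a diagonal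
  -- type coming from a root sits at half the weight.
  diagonalEntry-weight : ∀ {i s x p wt} → fromℤ wt ≈ - (fromℤ (+ 2) * fromℤ (+ i) * s) - fromℤ (+ 2) →
    fromℤ (ℤ.suc p) ≈ - x - fromℤ (+ i) * s → fromℤ (ℤ.suc p) ≈ x - fromℤ (+ i) * s → wt ≡ + 2 ℤ.* p
  diagonalEntry-weight {i} {s} {x} {p} wt≈ p≈ q≈ = fromℤ-injective (trans wt≈ (sym (trans (fromℤ.*-homo (+ 2) p)
    (trans (solve 1 (λ P → con (+ 2) :* P := con 1ℤ :+ P :+ (con 1ℤ :+ P) :- con (+ 2)) refl (fromℤ p))
    (trans (+-congʳ (+-cong (trans (sym (fromℤ.+-homo 1ℤ p)) p≈) (trans (sym (fromℤ.+-homo 1ℤ p)) q≈)))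
      (solve 3 (λ x I s → :- x :- I :* s :+ (x :- I :* s) :- con (+ 2) := :- (con (+ 2) :* I :* s) :- con (+ 2))
        refl x (fromℤ (+ i)) s))))))

-- Hodge types attached to a parabolic

filter-Pointwise : ∀ {A B : Set} {R : A → B → Set} {Q : B → Set} {P : A → Set} (P? : Decidable P) {xs ys} →
  Pointwise R xs ys → All Q ys → length (filter P? xs) ≡ 0 ⊎ ∃ λ x → ∃ λ y → P x × Q y × R x y
filter-Pointwise P? [] [] = inj₁ ≡.refl
filter-Pointwise P? {x ∷ xs} {y ∷ ys} (Rxy ∷ rs) (Qy ∷ qs) with P? x
... | yes Px = inj₂ (x , y , Px , Qy , Rxy)
... | no  _  = filter-Pointwise P? rs qs

dimension-zero : ∀ {R : CRing} (V : Mod R) → HasDimension V 0 → ∀ x → Module._≈ᴹ_ V x (Module.0ᴹ V)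
dimension-zero V (_ , _ , spans) x = proj₂ (spans x)

even≢odd : ∀ j k → + 2 ℤ.* j ≢ + 2 ℤ.* k ℤ.+ 1ℤ
even≢odd j k eq = ℕₚ.even≢odd ℤ.∣ j ℤ.- k ∣ 0 (≡.trans (≡.sym (ℤₚ.abs-* (+ 2) (j ℤ.- k))) (≡.cong ℤ.∣_∣ difference))
  where
  open ≡.≡-Reasoning
  difference : + 2 ℤ.* (j ℤ.- k) ≡ 1ℤ
  difference = begin
    + 2 ℤ.* (j ℤ.- k)                             ≡⟨ ℤₚ.*-distribˡ-+ (+ 2) j (ℤ.- k) ⟩
    + 2 ℤ.* j ℤ.+ + 2 ℤ.* (ℤ.- k)                 ≡⟨ ≡.cong₂ ℤ._+_ eq (≡.sym (ℤₚ.neg-distribʳ-* (+ 2) k)) ⟩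
    + 2 ℤ.* k ℤ.+ 1ℤ ℤ.- + 2 ℤ.* k                ≡⟨ ≡.cong (ℤ._- + 2 ℤ.* k) (ℤₚ.+-comm (+ 2 ℤ.* k) 1ℤ) ⟩
    1ℤ ℤ.+ + 2 ℤ.* k ℤ.- + 2 ℤ.* k                ≡⟨ ℤₚ.+-assoc 1ℤ (+ 2 ℤ.* k) (ℤ.- (+ 2 ℤ.* k)) ⟩
    1ℤ ℤ.+ (+ 2 ℤ.* k ℤ.- + 2 ℤ.* k)              ≡⟨ ≡.cong (ℤ._+_ 1ℤ) (ℤₚ.+-inverseʳ (+ 2 ℤ.* k)) ⟩
    1ℤ                                            ∎

module _ (em : ExcludedMiddle 0ℓ) (ℝ : CompleteOrderedField) (G : BasedRootDatum) (α : Fin (BasedRootDatum.rank G)) where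
  open CompleteOrderedField ℝ
  open OrderedField ℝ
  open MaximalParabolic em ℝ G α
  open BasedRootDatum G using (N; coroot)

  -- For `b = ⊤⁺` the inequality on s is void, but then no root in this degree has a positive
  -- pairing. For finite `b`, clearing the denominator gives is ≤ b - 1, and `b` is at most the
  -- pairing.
  is≤x-1 : ∀ {μ i b s γ} → 1 ℕ.≤ i → IsLeastPositive μ i b → s ≤[ b -1]/ i →
    InN^ i γ → 0# < ⟪ μ , coroot γ ⟫ → fromℤ (+ i) * s ≤ ⟪ μ , coroot γ ⟫ - 1#
  is≤x-1 {b = ⊤⁺} {γ = γ} 1≤i none _ γ∈ 0<x = ⊥-elim (none γ γ∈ 0<x)
  is≤x-1 {i = i} {b = [ b ]} {s} {γ} 1≤i (_ , _ , least) s≤ γ∈ 0<x =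
    ≤.trans (s≤cr⇒as≤c (0≤fromℤ i) (recip-inverseʳ em ring′ (fromℤ-unit em 1≤i)) s≤)
      (+-monoˡ-≤ (- 1#) (least γ γ∈ 0<x))

  HodgeTypeOf : X⊗ℝ → ℕ → Carrier → ℤ × ℤ → Fin N → Set
  HodgeTypeOf μ i s (p , q) γ = fromℤ p ≈ - ⟪ μ , coroot γ ⟫ - fromℤ (+ i) * s
                              × fromℤ q ≈ ⟪ μ , coroot γ ⟫ - fromℤ (+ i) * s

  multiplicity-zero⊎occurs : ∀ {μ i s L} → IsHodgeTypeList μ i s L → ∀ pq →
    length (filter (λ xy → ≡-dec ℤₚ._≟_ ℤₚ._≟_ xy pq) L) ≡ 0 ⊎ ∃ λ γ → InN^ i γ × HodgeTypeOf μ i s pq γ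
  multiplicity-zero⊎occurs {μ} {i} {s} {L} L-type pq
    with filter-Pointwise {R = HodgeTypeOf μ i s} {Q = InN^ i} (λ xy → ≡-dec ℤₚ._≟_ ℤₚ._≟_ xy pq) L-type
           (all-filter (λ γ → em {InN^ i γ}) (allFin N))
  ... | inj₁ none = inj₁ none
  ... | inj₂ (_ , γ , ≡.refl , γ∈ , pq≈) = inj₂ (γ , γ∈ , pq≈)

  private
    suc<0⇒<0 : ∀ {p} → ℤ.suc p ℤ.< 0ℤ → p ℤ.< 0ℤ
    suc<0⇒<0 {p} = ℤₚ.≤-<-trans (ℤₚ.i≤suc[i] p)

    0<suc⇒0≤ : ∀ {p} → 0ℤ ℤ.< ℤ.suc p → 0ℤ ℤ.≤ p
    0<suc⇒0≤ {p} 0<1+p = ≡.subst (0ℤ ℤ.≤_) (ℤₚ.pred-suc p) (ℤₚ.i<j⇒i≤pred[j] 0<1+p)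

  module _ {μ : X⊗ℝ} {i : ℕ} (1≤i : 1 ℕ.≤ i) {s : Carrier} (0<s : 0# < s) where

    straddles-zero : ∀ {b} → IsLeastPositive μ i b → s ≤[ b -1]/ i → ∀ {p q γ} → p ℤ.< q →
      InN^ i γ → HodgeTypeOf μ i s (ℤ.suc p , ℤ.suc q) γ → p ℤ.< 0ℤ × 0ℤ ℤ.≤ q
    straddles-zero b-least s≤ {p} {q} {γ} p<q γ∈ (p≈ , q≈) =
      suc<0⇒<0 (H.p≤q⇒p<0 (ℤₚ.<⇒≤ 1+p<1+q)) ,
      0<suc⇒0≤ (H.is≤x-1⇒0<q (is≤x-1 {μ} {i} 1≤i b-least s≤ γ∈ (H.p<q⇒0<x 1+p<1+q)))
      where
      1+p<1+q : ℤ.suc p ℤ.< ℤ.suc q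
      1+p<1+q = ℤₚ.+-monoʳ-< 1ℤ p<q
      module H = HodgeEntry {i} 1≤i {s} {⟪ μ , coroot γ ⟫} {ℤ.suc p} {ℤ.suc q} 0<s p≈ q≈

    diagonal-negative : ∀ {p γ} → HodgeTypeOf μ i s (ℤ.suc p , ℤ.suc p) γ → p ℤ.< 0ℤ
    diagonal-negative {p} {γ} (p≈ , q≈) = suc<0⇒<0
      (HodgeEntry.p≤q⇒p<0 {i} 1≤i {s} {⟪ μ , coroot γ ⟫} {ℤ.suc p} {ℤ.suc p} 0<s p≈ q≈ ℤₚ.≤-refl)

  diagonal-weight : ∀ {μ i s wt p γ} → fromℤ wt ≈ - (fromℤ (+ 2) * fromℤ (+ i) * s) - fromℤ (+ 2) →
    HodgeTypeOf μ i s (ℤ.suc p , ℤ.suc p) γ → wt ≡ + 2 ℤ.* p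
  diagonal-weight {μ} {i} {s} {wt} {p} {γ} wt≈ (p≈ , q≈) =
    diagonalEntry-weight {i} {s} {⟪ μ , coroot γ ⟫} {p} {wt} wt≈ p≈ q≈

-- Criticality of the twist

module TypeShiftedMotive (em : ExcludedMiddle 0ℓ) (ℝ : CompleteOrderedField) (K : NumberField (CompleteOrderedField.ℂ ℝ))
    (G : BasedRootDatum) (α : Fin (BasedRootDatum.rank G)) where
  open CompleteOrderedField ℝ
  open Premotivic ℂ K
  open MaximalParabolic em ℝ G α

  -- M is the Tate twist itself, so its Hodge type is L moved by (-1 , -1).
  module Criticality
      (λ∞ : X⊗ℝ) (i : ℕ) (1≤i : 1 ℕ.≤ i) (b : Carrier ⁺) (b-least : IsLeastPositive λ∞ i b) (s : Carrier)
      (M : PremotivicStructure) (L : List (ℤ × ℤ)) (L-type : IsHodgeTypeList λ∞ i s L)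
      (M-type : ∀ p q → PremotivicStructure.h[_,_]≡_ M p q
        (length (filter (λ pq → ≡-dec ℤₚ._≟_ ℤₚ._≟_ pq (ℤ.suc p , ℤ.suc q)) L)))
      (wt : ℤ) (wt≈ : fromℤ wt ≈ - (fromℤ (+ 2) * fromℤ (+ i) * s) - fromℤ (+ 2)) where
    open PremotivicStructure M
    open OrderedField ℝ
    open NumberField K
    private
      module T = Module (H-B ⊗ℂ)
      module fromℚ = RingHomomorphism fromℚ

      Vanishing : ℤ → ℤ → Set
      Vanishing p q = ∀ {x} → x ∈ˢ H p q → x T.≈ᴹ T.0ᴹ

      dimension-zero⇒vanishing : ∀ {p q n} → n ≡ 0 → h[ p , q ]≡ n → Vanishing p q
      dimension-zero⇒vanishing {p} {q} ≡.refl h≡0 x∈H = dimension-zero (subModule (H-B ⊗ℂ) (H p q)) h≡0 (_ , x∈H)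

      vanishing⊎occurs : ∀ p q → Vanishing p q ⊎ ∃ λ γ → InN^ i γ × HodgeTypeOf em ℝ G α λ∞ i s (ℤ.suc p , ℤ.suc q) γ
      vanishing⊎occurs p q = Sum.map₁ (λ none → dimension-zero⇒vanishing {p} {q} none (M-type p q))
        (multiplicity-zero⊎occurs em ℝ G α {λ∞} {i} {s} L-type (ℤ.suc p , ℤ.suc q))

      E-half : HasHalf E-ring
      E-half = fromℚ.⟦ ½ℚ ⟧ , E.trans (E.sym (fromℚ.+-homo ½ℚ ½ℚ)) fromℚ.1#-homo
        where module E = CommutativeRing E-ring

      open PeriodMap em ℂ (ℂ-zeroOrUnit em) ℂ-nonZero K (field-zeroOrUnit E em) E-half M

    -- At k = wt/2 this is the common form of the two cases of the theorem: there is no such k for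
    -- odd weight, the condition is trivial when the middle piece is zero, and it says t = 0 when
    -- F_∞ acts by a scalar on a non-zero middle piece.
    FixesDiagonal : ℤ → Set
    FixesDiagonal k = ∀ {x} → x ∈ˢ H k k → (F∞ Bℂ.⊗id) x Bℂ.≈⊗ x

    module _ (diagonal-fixed : ∀ k → wt ≡ + 2 ℤ.* k → FixesDiagonal k)
             (0<s : 0# < s) (s≤ : s ≤[ b -1]/ i) where
      private
        straddles : ∀ {p q γ} → p ℤ.< q → InN^ i γ → HodgeTypeOf em ℝ G α λ∞ i s (ℤ.suc p , ℤ.suc q) γ → p ℤ.< 0ℤ × 0ℤ ℤ.≤ q
        straddles = straddles-zero em ℝ G α {λ∞} {i} 1≤i {s} 0<s {b} b-least s≤

        Occurs : ℤ → ℤ → Set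
        Occurs p q = ∃ λ γ → InN^ i γ × HodgeTypeOf em ℝ G α λ∞ i s (ℤ.suc p , ℤ.suc q) γ

        case-< : ∀ {p q} → p ℤ.< q → Vanishing p q ⊎ Occurs p q → HodgeCase p q
        case-< p<q (inj₁ H≈0) = vanishing H≈0
        case-< p<q (inj₂ (γ , γ∈ , pq≈)) = let p<0 , 0≤q = straddles p<q γ∈ pq≈ in p<0≤q p<0 0≤q

        -- The bound speaks about (q,p), whose pairing is positive. If (q,p) occurs, its
        -- inequalities are already those wanted for (p,q); if it does not, F_∞ makes H^{p,q} vanish
        -- too.
        case-> : ∀ {p q} → q ℤ.< p → Vanishing q p ⊎ Occurs q p → HodgeCase p q
        case-> q<p (inj₁ H≈0) = vanishing (exchange-vanishing H≈0)
        case-> q<p (inj₂ (γ , γ∈ , qp≈)) = let q<0 , 0≤p = straddles q<p γ∈ qp≈ in q<0≤p q<0 0≤p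

        case-≡ : ∀ {p} → Vanishing p p ⊎ Occurs p p → HodgeCase p p
        case-≡ (inj₁ H≈0) = vanishing H≈0
        case-≡ {p} (inj₂ (γ , _ , pp≈)) = fixed (diagonal-negative em ℝ G α {λ∞} {i} 1≤i {s} 0<s {p} {γ} pp≈)
          (diagonal-fixed p (diagonal-weight em ℝ G α {λ∞} {i} {s} {wt} {p} {γ} wt≈ pp≈))

        case-cmp : ∀ {p q} → Tri (p ℤ.< q) (p ≡ q) (q ℤ.< p) → HodgeCase p q
        case-cmp {p} {q} (tri< p<q _ _)    = case-< p<q (vanishing⊎occurs p q)
        case-cmp {p} {q} (tri≈ _ ≡.refl _) = case-≡ (vanishing⊎occurs p p)
        case-cmp {p} {q} (tri> _ _ q<p)    = case-> q<p (vanishing⊎occurs q p)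

        hodgeCase : ∀ p q → HodgeCase p q
        hodgeCase p q = case-cmp (ℤₚ.<-cmp p q)

      isCritical : IsCritical
      isCritical = hodgeCases⇒critical hodgeCase

    private
      diagonal-unique : ∀ {k} → wt ≡ + 2 ℤ.* k → FixesDiagonal k → ∀ j → wt ≡ + 2 ℤ.* j → FixesDiagonal j
      diagonal-unique {k} even fixed-k j even′ =
        ≡.subst FixesDiagonal (ℤₚ.*-cancelˡ-≡ (+ 2) k j (≡.trans (≡.sym even) even′)) fixed-k

    module _ (h : ℤ → ℤ → ℕ) (h-dim : ∀ p q → h[ p , q ]≡ h p q) where
      diagonal-fixed-vanishing : (∃[ k ] wt ≡ + 2 ℤ.* k ℤ.+ + 1) ⊎ (∃[ k ] wt ≡ + 2 ℤ.* k × h k k ≡ 0) →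
        ∀ k → wt ≡ + 2 ℤ.* k → FixesDiagonal k
      diagonal-fixed-vanishing (inj₁ (j , odd)) k even = ⊥-elim (even≢odd k j (≡.trans (≡.sym even) odd))
      diagonal-fixed-vanishing (inj₂ (j , even , h≡0)) = diagonal-unique even λ x∈H →
        T.≈ᴹ-trans (H≈0 (F∞-exchanges j j x∈H)) (T.≈ᴹ-sym (H≈0 x∈H))
        where
        H≈0 : Vanishing j j
        H≈0 = dimension-zero⇒vanishing {j} {j} h≡0 (h-dim j j)

      scalar-sign : ∀ {k} → h k k ≢ 0 → ∀ {c} → (∀ x → x ∈ˢ H k k → (F∞ Bℂ.⊗id) x Bℂ.≈⊗ c Bℂ.• x) →
        c ℂ.≈ ℂ.1# ⊎ c ℂ.≈ ℂ.- ℂ.1#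
      scalar-sign {k} h≢0 F≈c = x²≈1⇒x≈±1 ℂ (ℂ-zeroOrUnit em)
        (scalar-square {k} (h-dim k k) h≢0 F≈c)

    diagonal-fixed-scalar : ∀ {k} → wt ≡ + 2 ℤ.* k → ∀ {c} →
      (∀ x → x ∈ˢ H k k → (F∞ Bℂ.⊗id) x Bℂ.≈⊗ c Bℂ.• x) → c ℂ.≈ ℂ.1# →
      ∀ j → wt ≡ + 2 ℤ.* j → FixesDiagonal j
    diagonal-fixed-scalar even F≈c c≈1 = diagonal-unique even λ {x} x∈H →
      T.≈ᴹ-trans (F≈c x x∈H) (T.≈ᴹ-trans (T.*ₗ-congʳ {x} c≈1) (T.*ₗ-identityˡ x))

proposition3p2 : (em : ExcludedMiddle 0ℓ) (ℝ : CompleteOrderedField) →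
    let open CompleteOrderedField ℝ in
    (π : Carrier) (π-isPi : IsPi em ℝ π) (K : NumberField ℂ) →
    let open Premotivic ℂ K in
    (G : BasedRootDatum) (α : Fin (BasedRootDatum.rank G)) →
    let open MaximalParabolic em ℝ G α in
    (λ∞ : X⊗ℝ) → IsInfinitesimalCharacter λ∞ →
    (m : ℕ) → IsLargestDegree m →
    (i : ℕ) → 1 ℕ.≤ i → i ℕ.≤ m →
    (b : Carrier ⁺) → IsLeastPositive λ∞ i b →
    (s : Carrier) → AlgebraicallyIntegral (λ∞ +ᴹ s *ₗ α̃) →
    (M : PremotivicStructure) (L : List (ℤ × ℤ)) →
    IsHodgeTypeList λ∞ i s L → PremotivicStructure.HasHodgeType M L →
    let open PremotivicStructure (twist₁ em ℝ K π π-isPi M) in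
    (wt : ℤ) → fromℤ wt ≈ - (fromℤ (+ 2) * fromℤ (+ i) * s) - fromℤ (+ 2) →
    (h : ℤ → ℤ → ℕ) → (∀ p q → h[ p , q ]≡ h p q) →
    ( (∃[ k ] wt ≡ + 2 ℤ.* k ℤ.+ + 1) ⊎ (∃[ k ] wt ≡ + 2 ℤ.* k × h k k ≡ 0) →
    0# < s → s ≤[ b -1]/ i → IsCritical )
    ×
    ( ∀ k → wt ≡ + 2 ℤ.* k → h k k ≢ 0 →
    (c : ℂ.Carrier) → (∀ x → x ∈ˢ H k k → (F∞ Bℂ.⊗id) x Bℂ.≈⊗ c Bℂ.• x) →
    ∃[ t ] (t ≡ 0 ⊎ t ≡ 1) × c ℂ.≈ Exp._^_ ℂ.semiring (ℂ.- ℂ.1#) t ×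
    (t ≡ 0 → 0# < s → s ≤[ b -1]/ i → IsCritical) )
proposition3p2 em ℝ π π-isPi K G α λ∞ _ m _ i 1≤i _ b b-least s _ M L L-type M-type wt wt≈ h h-dim =
  (λ parity → isCritical (diagonal-fixed-vanishing h h-dim parity)) ,
  λ k even h≢0 c F≈c → scalarCase k even F≈c (scalar-sign h h-dim h≢0 F≈c)
  where
  open CompleteOrderedField ℝ
  open Premotivic ℂ K
  open MaximalParabolic em ℝ G α
  M′ : PremotivicStructure
  M′ = twist₁ em ℝ K π π-isPi M
  open PremotivicStructure M′
  open TypeShiftedMotive em ℝ K G α
  -- The twist defines its piece at (p,q) as the piece of `M` at (p + 1, q + 1), so the dimensions
  -- known for `M` apply after shifting the arguments.
  open Criticality λ∞ i 1≤i b b-least s M′ L L-type (λ p q → M-type (ℤ.suc p) (ℤ.suc q)) wt wt≈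
  scalarCase : ∀ k → wt ≡ + 2 ℤ.* k → ∀ {c} → (∀ x → x ∈ˢ H k k → (F∞ Bℂ.⊗id) x Bℂ.≈⊗ c Bℂ.• x) →
    c ℂ.≈ ℂ.1# ⊎ c ℂ.≈ ℂ.- ℂ.1# →
    ∃[ t ] (t ≡ 0 ⊎ t ≡ 1) × c ℂ.≈ Exp._^_ ℂ.semiring (ℂ.- ℂ.1#) t ×
           (t ≡ 0 → 0# < s → s ≤[ b -1]/ i → IsCritical)
  scalarCase k even F≈c (inj₁ c≈1)  = 0 , inj₁ ≡.refl , c≈1 , λ _ → isCritical (diagonal-fixed-scalar even F≈c c≈1)
  -- The power with exponent 1 unfolds to -1 times 1, hence the identity law. The implication from
  -- `t ≡ 0` is vacuous for t = 1.
  scalarCase k even F≈c (inj₂ c≈-1) = 1 , inj₂ ≡.refl , ℂ.trans c≈-1 (ℂ.sym (ℂ.*-identityʳ _)) , λ ()
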